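{- For all positive integers $m,n$, \[ \gcd\left(\frac{[2m]![2n]!}{[m+n]![m]![n]!},\,[2m+1]\right)=1, \] the gcd being taken in the polynomial ring $\mathbb{Q}[q]$ (equivalently, the two polynomials have no common cyclotomic factor).
   Context: For a non-negative integer $n$, $[n]=1+q+\cdots+q^{n-1}$ and $[n]!=[n][n-1]\cdots[1]$ (with $[0]!=1$). The quotient $\frac{[2m]![2n]!}{[m+n]![m]![n]!}$ (the $q$-super Catalan number) is a polynomial in $q$. -}

module Defs where

open import Data.Nat using (ℕ; zero; suc)
open import Data.List using (List; []; _∷_; map; replicate)
open import Data.Product using (∃)
open import Data.Rational using (ℚ; 0ℚ; 1ℚ)
import Data.Rational as Q
open import Relation.Binary.PropositionalEquality using (_≡_)

-- Polynomials in ℚ[q] as coefficient lists, lowest degree first.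
-- Trailing zeros are allowed; equality is coefficientwise (_≈ₚ_).
Poly : Set
Poly = List ℚ

coeff : Poly → ℕ → ℚ
coeff []       _       = 0ℚ
coeff (a ∷ p)  zero    = a
coeff (a ∷ p)  (suc i) = coeff p i

_≈ₚ_ : Poly → Poly → Set
p ≈ₚ r = ∀ i → coeff p i ≡ coeff r i

infixl 6 _+ₚ_
infixl 7 _*ₚ_
infix 4 _≈ₚ_ _∣ₚ_

_+ₚ_ : Poly → Poly → Poly
[]      +ₚ r       = r
(a ∷ p) +ₚ []      = a ∷ p
(a ∷ p) +ₚ (b ∷ r) = (a Q.+ b) ∷ (p +ₚ r)

_*ₚ_ : Poly → Poly → Poly
[]      *ₚ r = []
(a ∷ p) *ₚ r = map (a Q.*_) r +ₚ (0ℚ ∷ (p *ₚ r))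

oneₚ : Poly
oneₚ = 1ℚ ∷ []

_∣ₚ_ : Poly → Poly → Set
d ∣ₚ f = ∃ λ g → d *ₚ g ≈ₚ f

-- gcd(f, g) = 1 in ℚ[q]: every common divisor is a unit (divides 1)
GcdOne : Poly → Poly → Set
GcdOne f g = ∀ d → d ∣ₚ f → d ∣ₚ g → d ∣ₚ oneₚ

-- q-integer [n] = 1 + q + ... + q^(n-1)
qint : ℕ → Poly
qint n = replicate n 1ℚ

qfact : ℕ → Poly
qfact zero    = oneₚ
qfact (suc n) = qint (suc n) *ₚ qfact n

module Submission where

-- Since
-- irreducibility is not decidable, we use "decisive" factors instead: a
-- non-unit p dividing or coprime to each of [0], ..., [K-1]; every non-unit
-- has one.  Let p be a decisive factor of a common divisor of S and [2m+1],
-- and e the least positive integer with p | [e].  As q is invertible modulo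
-- p, p | [k] only if e | k, and [k]! = [e]^⌊k/e⌋·U with U coprime to p
-- (since [je] = [e]·(1 + q^e + ...) and the second factor is ≡ j mod [e]).
-- As e | 2m+1, the powers of [e] on both sides of
-- S·[m+n]![m]![n]! = [2m]![2n]! agree (multiples-balance); cancelling them,
-- p would divide a product of polynomials coprime to p, which is absurd.

open import Defs
open import Data.Nat
  using (ℕ; zero; suc; _+_; _*_; _∸_; _≤_; _<_; z≤n; s≤s; NonZero; >-nonZero; _/_; _%_)
open import Data.Nat.Properties
  using ( ≤-refl; ≤-trans; ≤-pred; ≤-antisym; n≤1+n; <⇒≱; ≮⇒≥; ≰⇒>; _<?_; _≤?_
        ; m≤m+n; m≤n+m; +-mono-≤; +-mono-<; +-monoʳ-≤; +-suc; +-comm; +-identityʳ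
        ; m∸n+n≡m; 0≢1+n; suc-injective; m+n≡0⇒m≡0; n≤0⇒n≡0; m≤n⇒m<n∨m≡n
        ; +-cancelʳ-<; ≤-reflexive; <⇒≤; +-assoc; <-trans; n<1+n; ≤-<-trans
        ; module ≤-Reasoning )
open import Data.Nat.DivMod using (m≡m%n+[m/n]*n; m%n<n)
open import Data.List using ([]; _∷_; map)
open import Data.Product using (Σ; _,_; proj₁; proj₂; _×_)
open import Data.Sum using (_⊎_; inj₁; inj₂)
open import Data.Empty using (⊥; ⊥-elim)
open import Data.Nat.Divisibility
  using (_∣?_; ∣⇒≤; ∣m+n∣m⇒∣n; ∣m∣n⇒∣m+n; n∣m*n; m%n≡0⇒n∣m; divides)
  renaming (_∣_ to _∣ℕ_; ∣-refl to ∣ℕ-refl)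
open import Data.Nat.Solver using () renaming (module +-*-Solver to NatSolver)
open import Data.Maybe using (Maybe; just; _>>=_)
open import Data.Rational as ℚ using (ℚ; 0ℚ; 1ℚ)
import Data.Rational.Properties as ℚₚ
open import Algebra.Bundles using (CommutativeRing; CommutativeMonoid; RawRing)
import Algebra.Properties.CommutativeSemigroup as CommSemigroupProperties
import Algebra.Solver.Ring
import Algebra.Solver.Ring.AlmostCommutativeRing as ACR
open import Level using (0ℓ)
open import Relation.Nullary using (yes; no; ¬_)
open import Relation.Nullary.Decidable using (dec⇒maybe)
open import Relation.Binary.Structures using (IsEquivalence)
open import Relation.Binary.Bundles using (Setoid)
import Relation.Binary.Reasoning.Setoid as SetoidReasoning
open import Relation.Binary.PropositionalEquality
  using (_≡_; _≢_; refl; sym; trans; cong; cong₂; subst; subst₂; module ≡-Reasoning)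

open CommSemigroupProperties
  (CommutativeMonoid.commutativeSemigroup ℚₚ.+-0-commutativeMonoid)
  using (interchange; x∙yz≈y∙xz)

scale : ℚ → Poly → Poly
scale a p = map (a ℚ.*_) p

shift : Poly → Poly
shift p = 0ℚ ∷ p

negₚ : Poly → Poly
negₚ p = map ℚ.-_ p

zeroₚ : Poly
zeroₚ = []

coeff-+ : ∀ p r i → coeff (p +ₚ r) i ≡ coeff p i ℚ.+ coeff r i
coeff-+ []      r       i       = sym (ℚₚ.+-identityˡ (coeff r i))
coeff-+ (a ∷ p) []      i       = sym (ℚₚ.+-identityʳ (coeff (a ∷ p) i))
coeff-+ (a ∷ p) (b ∷ r) zero    = refl
coeff-+ (a ∷ p) (b ∷ r) (suc i) = coeff-+ p r i

coeff-scale : ∀ a p i → coeff (scale a p) i ≡ a ℚ.* coeff p i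
coeff-scale a []      i       = sym (ℚₚ.*-zeroʳ a)
coeff-scale a (x ∷ p) zero    = refl
coeff-scale a (x ∷ p) (suc i) = coeff-scale a p i

coeff-neg : ∀ p i → coeff (negₚ p) i ≡ ℚ.- coeff p i
coeff-neg []      i       = refl
coeff-neg (x ∷ p) zero    = refl
coeff-neg (x ∷ p) (suc i) = coeff-neg p i

-- Coefficientwise equality, wrapped in a record so that both polynomials
-- can be recovered by unification (the frozen _≈ₚ_ is a Π-type).
infix 4 _≋_
record _≋_ (p r : Poly) : Set where
  constructor coeffwise
  field at : ∀ i → coeff p i ≡ coeff r i
open _≋_

≋-refl : ∀ {p} → p ≋ p
≋-refl = coeffwise λ i → refl

≋-sym : ∀ {p r} → p ≋ r → r ≋ p
≋-sym e = coeffwise λ i → sym (at e i)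

≋-trans : ∀ {p r s} → p ≋ r → r ≋ s → p ≋ s
≋-trans e f = coeffwise λ i → trans (at e i) (at f i)

≋-isEquivalence : IsEquivalence _≋_
≋-isEquivalence = record { refl = ≋-refl ; sym = ≋-sym ; trans = ≋-trans }

≋-setoid : Setoid 0ℓ 0ℓ
≋-setoid = record { isEquivalence = ≋-isEquivalence }

module ≋-Reasoning = SetoidReasoning ≋-setoid

≋-cons : ∀ {a b p r} → a ≡ b → p ≋ r → a ∷ p ≋ b ∷ r
≋-cons a≡b p≋r = coeffwise λ { zero → a≡b ; (suc i) → at p≋r i }

≋-[]-cons : ∀ {a p} → a ≡ 0ℚ → p ≋ [] → a ∷ p ≋ []
≋-[]-cons a≡0 p≋0 = coeffwise λ { zero → a≡0 ; (suc i) → at p≋0 i }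

tail≋ : ∀ {a b p r} → a ∷ p ≋ b ∷ r → p ≋ r
tail≋ e = coeffwise λ i → at e (suc i)

tail≋[] : ∀ {a p} → a ∷ p ≋ [] → p ≋ []
tail≋[] e = coeffwise λ i → at e (suc i)

+ₚ-cong : ∀ {p p′ r r′} → p ≋ p′ → r ≋ r′ → p +ₚ r ≋ p′ +ₚ r′
+ₚ-cong {p} {p′} {r} {r′} e f = coeffwise λ i → begin
  coeff (p +ₚ r) i          ≡⟨ coeff-+ p r i ⟩
  coeff p i ℚ.+ coeff r i   ≡⟨ cong₂ ℚ._+_ (at e i) (at f i) ⟩
  coeff p′ i ℚ.+ coeff r′ i ≡⟨ coeff-+ p′ r′ i ⟨
  coeff (p′ +ₚ r′) i        ∎
  where open ≡-Reasoning

+ₚ-congˡ : ∀ {p p′} r → p ≋ p′ → p +ₚ r ≋ p′ +ₚ r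
+ₚ-congˡ r e = +ₚ-cong e ≋-refl

+ₚ-congʳ : ∀ p {r r′} → r ≋ r′ → p +ₚ r ≋ p +ₚ r′
+ₚ-congʳ p e = +ₚ-cong ≋-refl e

shift-cong : ∀ {p p′} → p ≋ p′ → shift p ≋ shift p′
shift-cong = ≋-cons refl

negₚ-cong : ∀ {p p′} → p ≋ p′ → negₚ p ≋ negₚ p′
negₚ-cong {p} {p′} e = coeffwise λ i →
  trans (coeff-neg p i) (trans (cong ℚ.-_ (at e i)) (sym (coeff-neg p′ i)))

+ₚ-comm : ∀ p r → p +ₚ r ≋ r +ₚ p
+ₚ-comm p r = coeffwise λ i →
  trans (coeff-+ p r i) (trans (ℚₚ.+-comm (coeff p i) (coeff r i)) (sym (coeff-+ r p i)))

+ₚ-assoc : ∀ p r s → (p +ₚ r) +ₚ s ≋ p +ₚ (r +ₚ s)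
+ₚ-assoc p r s = coeffwise λ i → begin
  coeff ((p +ₚ r) +ₚ s) i                         ≡⟨ coeff-+ (p +ₚ r) s i ⟩
  coeff (p +ₚ r) i ℚ.+ coeff s i                  ≡⟨ cong (ℚ._+ coeff s i) (coeff-+ p r i) ⟩
  (coeff p i ℚ.+ coeff r i) ℚ.+ coeff s i         ≡⟨ ℚₚ.+-assoc (coeff p i) (coeff r i) (coeff s i) ⟩
  coeff p i ℚ.+ (coeff r i ℚ.+ coeff s i)         ≡⟨ cong (coeff p i ℚ.+_) (coeff-+ r s i) ⟨
  coeff p i ℚ.+ coeff (r +ₚ s) i                  ≡⟨ coeff-+ p (r +ₚ s) i ⟨
  coeff (p +ₚ (r +ₚ s)) i                         ∎
  where open ≡-Reasoning

+ₚ-identityʳ : ∀ p → p +ₚ zeroₚ ≋ p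
+ₚ-identityʳ p = coeffwise λ i → trans (coeff-+ p [] i) (ℚₚ.+-identityʳ (coeff p i))

+ₚ-inverseˡ : ∀ p → negₚ p +ₚ p ≋ zeroₚ
+ₚ-inverseˡ p = coeffwise λ i →
  trans (coeff-+ (negₚ p) p i)
        (trans (cong (ℚ._+ coeff p i) (coeff-neg p i)) (ℚₚ.+-inverseˡ (coeff p i)))

+ₚ-inverseʳ : ∀ p → p +ₚ negₚ p ≋ zeroₚ
+ₚ-inverseʳ p = ≋-trans (+ₚ-comm p (negₚ p)) (+ₚ-inverseˡ p)

coeff-*-cons : ∀ a p r i → coeff ((a ∷ p) *ₚ r) i ≡ a ℚ.* coeff r i ℚ.+ coeff (shift (p *ₚ r)) i
coeff-*-cons a p r i =
  trans (coeff-+ (scale a r) (shift (p *ₚ r)) i) (cong (ℚ._+ coeff (shift (p *ₚ r)) i) (coeff-scale a r i))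

*ₚ-zeroˡ : ∀ p r → p ≋ [] → p *ₚ r ≋ []
*ₚ-zeroˡ []      r e = ≋-refl
*ₚ-zeroˡ (a ∷ p) r e = coeffwise λ i → begin
  coeff ((a ∷ p) *ₚ r) i                         ≡⟨ coeff-*-cons a p r i ⟩
  a ℚ.* coeff r i ℚ.+ coeff (shift (p *ₚ r)) i   ≡⟨ cong₂ ℚ._+_ (a·r≡0 i) (tail≡0 i) ⟩
  0ℚ ℚ.+ 0ℚ                                      ≡⟨ ℚₚ.+-identityʳ 0ℚ ⟩
  0ℚ                                             ∎
  where
  open ≡-Reasoning
  a·r≡0 : ∀ i → a ℚ.* coeff r i ≡ 0ℚ
  a·r≡0 i = trans (cong (ℚ._* coeff r i) (at e zero)) (ℚₚ.*-zeroˡ (coeff r i))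
  tail≡0 : ∀ i → coeff (shift (p *ₚ r)) i ≡ 0ℚ
  tail≡0 zero    = refl
  tail≡0 (suc i) = at (*ₚ-zeroˡ p r (tail≋[] e)) i

*ₚ-congˡ : ∀ {p p′} r → p ≋ p′ → p *ₚ r ≋ p′ *ₚ r
*ₚ-congˡ {[]}    {p′}     r e = ≋-sym (*ₚ-zeroˡ p′ r (≋-sym e))
*ₚ-congˡ {a ∷ p} {[]}     r e = *ₚ-zeroˡ (a ∷ p) r e
*ₚ-congˡ {a ∷ p} {a′ ∷ p′} r e =
  +ₚ-cong (coeffwise λ i →
             trans (coeff-scale a r i)
                   (trans (cong (ℚ._* coeff r i) (at e zero)) (sym (coeff-scale a′ r i))))
          (shift-cong (*ₚ-congˡ r (tail≋ e)))

*ₚ-zeroʳ : ∀ p → p *ₚ [] ≋ []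
*ₚ-zeroʳ []      = ≋-refl
*ₚ-zeroʳ (a ∷ p) = ≋-[]-cons refl (*ₚ-zeroʳ p)

*ₚ-identityˡ : ∀ p → oneₚ *ₚ p ≋ p
*ₚ-identityˡ p = coeffwise λ i → begin
  coeff (oneₚ *ₚ p) i                        ≡⟨ coeff-*-cons 1ℚ [] p i ⟩
  1ℚ ℚ.* coeff p i ℚ.+ coeff (shift []) i    ≡⟨ cong (1ℚ ℚ.* coeff p i ℚ.+_) (shift[]≡0 i) ⟩
  1ℚ ℚ.* coeff p i ℚ.+ 0ℚ                    ≡⟨ ℚₚ.+-identityʳ _ ⟩
  1ℚ ℚ.* coeff p i                           ≡⟨ ℚₚ.*-identityˡ _ ⟩
  coeff p i                                  ∎
  where
  open ≡-Reasoning
  shift[]≡0 : ∀ i → coeff (shift []) i ≡ 0ℚ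
  shift[]≡0 zero    = refl
  shift[]≡0 (suc i) = refl

shift-+ₚ : ∀ p r → shift (p +ₚ r) ≋ shift p +ₚ shift r
shift-+ₚ p r = ≋-cons (sym (ℚₚ.+-identityʳ 0ℚ)) ≋-refl

scale-+ₚ : ∀ a p r → scale a (p +ₚ r) ≋ scale a p +ₚ scale a r
scale-+ₚ a p r = coeffwise λ i → begin
  coeff (scale a (p +ₚ r)) i                         ≡⟨ coeff-scale a (p +ₚ r) i ⟩
  a ℚ.* coeff (p +ₚ r) i                             ≡⟨ cong (a ℚ.*_) (coeff-+ p r i) ⟩
  a ℚ.* (coeff p i ℚ.+ coeff r i)                    ≡⟨ ℚₚ.*-distribˡ-+ a _ _ ⟩
  a ℚ.* coeff p i ℚ.+ a ℚ.* coeff r i                ≡⟨ cong₂ ℚ._+_ (coeff-scale a p i) (coeff-scale a r i) ⟨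
  coeff (scale a p) i ℚ.+ coeff (scale a r) i        ≡⟨ coeff-+ (scale a p) (scale a r) i ⟨
  coeff (scale a p +ₚ scale a r) i                   ∎
  where open ≡-Reasoning

scale-scale : ∀ a b p → scale a (scale b p) ≋ scale (a ℚ.* b) p
scale-scale a b p = coeffwise λ i →
  trans (coeff-scale a (scale b p) i)
    (trans (cong (a ℚ.*_) (coeff-scale b p i))
      (trans (sym (ℚₚ.*-assoc a b _)) (sym (coeff-scale (a ℚ.* b) p i))))

scale-shift : ∀ a p → scale a (shift p) ≋ shift (scale a p)
scale-shift a p = ≋-cons (ℚₚ.*-zeroʳ a) ≋-refl

*ₚ-distribʳ : ∀ p p′ r → (p +ₚ p′) *ₚ r ≋ p *ₚ r +ₚ p′ *ₚ r
*ₚ-distribʳ []      p′       r = ≋-refl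
*ₚ-distribʳ (a ∷ p) []       r = ≋-sym (+ₚ-identityʳ _)
*ₚ-distribʳ (a ∷ p) (b ∷ p′) r = begin
  scale (a ℚ.+ b) r +ₚ shift ((p +ₚ p′) *ₚ r)
    ≈⟨ +ₚ-cong (scale-+ˡ a b r) (≋-trans (shift-cong (*ₚ-distribʳ p p′ r)) (shift-+ₚ (p *ₚ r) (p′ *ₚ r))) ⟩
  (scale a r +ₚ scale b r) +ₚ (shift (p *ₚ r) +ₚ shift (p′ *ₚ r))
    ≈⟨ +ₚ-interchange (scale a r) (scale b r) (shift (p *ₚ r)) (shift (p′ *ₚ r)) ⟩
  (a ∷ p) *ₚ r +ₚ (b ∷ p′) *ₚ r ∎
  where
  open ≋-Reasoning
  scale-+ˡ : ∀ a b r → scale (a ℚ.+ b) r ≋ scale a r +ₚ scale b r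
  scale-+ˡ a b r = coeffwise λ i →
    trans (coeff-scale (a ℚ.+ b) r i)
      (trans (ℚₚ.*-distribʳ-+ (coeff r i) a b)
        (trans (cong₂ ℚ._+_ (sym (coeff-scale a r i)) (sym (coeff-scale b r i)))
          (sym (coeff-+ (scale a r) (scale b r) i))))
  +ₚ-interchange : ∀ w x y z → (w +ₚ x) +ₚ (y +ₚ z) ≋ (w +ₚ y) +ₚ (x +ₚ z)
  +ₚ-interchange w x y z = coeffwise λ i →
    trans (coeff-+ (w +ₚ x) (y +ₚ z) i)
      (trans (cong₂ ℚ._+_ (coeff-+ w x i) (coeff-+ y z i))
        (trans (interchange (coeff w i) (coeff x i) (coeff y i) (coeff z i))
          (trans (cong₂ ℚ._+_ (sym (coeff-+ w y i)) (sym (coeff-+ x z i)))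
            (sym (coeff-+ (w +ₚ y) (x +ₚ z) i)))))

shift-*ₚ : ∀ p r → shift p *ₚ r ≋ shift (p *ₚ r)
shift-*ₚ p r = coeffwise λ i →
  trans (coeff-*-cons 0ℚ p r i)
    (trans (cong (ℚ._+ coeff (shift (p *ₚ r)) i) (ℚₚ.*-zeroˡ (coeff r i)))
      (ℚₚ.+-identityˡ _))

scale-*ₚ : ∀ a p r → scale a p *ₚ r ≋ scale a (p *ₚ r)
scale-*ₚ a []      r = ≋-refl
scale-*ₚ a (b ∷ p) r = begin
  scale (a ℚ.* b) r +ₚ shift (scale a p *ₚ r)
    ≈⟨ +ₚ-cong (≋-sym (scale-scale a b r)) (shift-cong (scale-*ₚ a p r)) ⟩
  scale a (scale b r) +ₚ shift (scale a (p *ₚ r))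
    ≈⟨ +ₚ-congʳ _ (≋-sym (scale-shift a (p *ₚ r))) ⟩
  scale a (scale b r) +ₚ scale a (shift (p *ₚ r))
    ≈⟨ ≋-sym (scale-+ₚ a (scale b r) (shift (p *ₚ r))) ⟩
  scale a ((b ∷ p) *ₚ r) ∎
  where open ≋-Reasoning

*ₚ-assoc : ∀ p r s → (p *ₚ r) *ₚ s ≋ p *ₚ (r *ₚ s)
*ₚ-assoc []      r s = ≋-refl
*ₚ-assoc (a ∷ p) r s = begin
  (scale a r +ₚ shift (p *ₚ r)) *ₚ s          ≈⟨ *ₚ-distribʳ (scale a r) (shift (p *ₚ r)) s ⟩
  scale a r *ₚ s +ₚ shift (p *ₚ r) *ₚ s       ≈⟨ +ₚ-cong (scale-*ₚ a r s) (shift-*ₚ (p *ₚ r) s) ⟩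
  scale a (r *ₚ s) +ₚ shift ((p *ₚ r) *ₚ s)   ≈⟨ +ₚ-congʳ _ (shift-cong (*ₚ-assoc p r s)) ⟩
  (a ∷ p) *ₚ (r *ₚ s)                         ∎
  where open ≋-Reasoning

*ₚ-consʳ : ∀ p b r → p *ₚ (b ∷ r) ≋ scale b p +ₚ shift (p *ₚ r)
*ₚ-consʳ []      b r = ≋-sym (≋-[]-cons refl ≋-refl)
*ₚ-consʳ (a ∷ p) b r = ≋-cons const-term tail-terms
  where
  const-term : a ℚ.* b ℚ.+ 0ℚ ≡ b ℚ.* a ℚ.+ 0ℚ
  const-term = cong (ℚ._+ 0ℚ) (ℚₚ.*-comm a b)
  tail-terms : scale a r +ₚ p *ₚ (b ∷ r) ≋ scale b p +ₚ (scale a r +ₚ shift (p *ₚ r))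
  tail-terms = coeffwise λ i →
    trans (coeff-+ (scale a r) (p *ₚ (b ∷ r)) i)
      (trans (cong (coeff (scale a r) i ℚ.+_)
                   (trans (at (*ₚ-consʳ p b r) i) (coeff-+ (scale b p) (shift (p *ₚ r)) i)))
        (trans (x∙yz≈y∙xz (coeff (scale a r) i) (coeff (scale b p) i) (coeff (shift (p *ₚ r)) i))
          (trans (cong (coeff (scale b p) i ℚ.+_) (sym (coeff-+ (scale a r) (shift (p *ₚ r)) i)))
            (sym (coeff-+ (scale b p) (scale a r +ₚ shift (p *ₚ r)) i)))))

*ₚ-comm : ∀ p r → p *ₚ r ≋ r *ₚ p
*ₚ-comm []      r = ≋-sym (*ₚ-zeroʳ r)
*ₚ-comm (a ∷ p) r =
  ≋-trans (+ₚ-congʳ (scale a r) (shift-cong (*ₚ-comm p r))) (≋-sym (*ₚ-consʳ r a p))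

*ₚ-congʳ : ∀ p {r r′} → r ≋ r′ → p *ₚ r ≋ p *ₚ r′
*ₚ-congʳ p {r} {r′} e = ≋-trans (*ₚ-comm p r) (≋-trans (*ₚ-congˡ p e) (*ₚ-comm r′ p))

*ₚ-cong : ∀ {p p′ r r′} → p ≋ p′ → r ≋ r′ → p *ₚ r ≋ p′ *ₚ r′
*ₚ-cong {p′ = p′} {r} e f = ≋-trans (*ₚ-congˡ r e) (*ₚ-congʳ p′ f)

*ₚ-identityʳ : ∀ p → p *ₚ oneₚ ≋ p
*ₚ-identityʳ p = ≋-trans (*ₚ-comm p oneₚ) (*ₚ-identityˡ p)

*ₚ-distribˡ : ∀ p r s → p *ₚ (r +ₚ s) ≋ p *ₚ r +ₚ p *ₚ s
*ₚ-distribˡ p r s = begin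
  p *ₚ (r +ₚ s)         ≈⟨ *ₚ-comm p (r +ₚ s) ⟩
  (r +ₚ s) *ₚ p         ≈⟨ *ₚ-distribʳ r s p ⟩
  r *ₚ p +ₚ s *ₚ p      ≈⟨ +ₚ-cong (*ₚ-comm r p) (*ₚ-comm s p) ⟩
  p *ₚ r +ₚ p *ₚ s      ∎
  where open ≋-Reasoning

ℚ[q] : CommutativeRing 0ℓ 0ℓ
ℚ[q] = record
  { Carrier = Poly ; _≈_ = _≋_ ; _+_ = _+ₚ_ ; _*_ = _*ₚ_ ; -_ = negₚ ; 0# = zeroₚ ; 1# = oneₚ
  ; isCommutativeRing = record
    { isRing = record
      { +-isAbelianGroup = record
        { isGroup = record
          { isMonoid = record
            { isSemigroup = record
              { isMagma = record { isEquivalence = ≋-isEquivalence ; ∙-cong = +ₚ-cong }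
              ; assoc = +ₚ-assoc }
            ; identity = (λ p → ≋-refl) , +ₚ-identityʳ }
          ; inverse = +ₚ-inverseˡ , +ₚ-inverseʳ
          ; ⁻¹-cong = negₚ-cong }
        ; comm = +ₚ-comm }
      ; *-cong = *ₚ-cong
      ; *-assoc = *ₚ-assoc
      ; *-identity = *ₚ-identityˡ , *ₚ-identityʳ
      ; distrib = *ₚ-distribˡ , (λ r p p′ → *ₚ-distribʳ p p′ r) }
    ; *-comm = *ₚ-comm } }

constₚ : ℚ → Poly
constₚ a = a ∷ []

module PolySolver where
  private
    ℚ-raw : RawRing 0ℓ 0ℓ
    ℚ-raw = ACR.AlmostCommutativeRing.rawRing (ACR.fromCommutativeRing ℚₚ.+-*-commutativeRing)

    constₚ-hom : ℚ-raw ACR.-Raw-AlmostCommutative⟶ ACR.fromCommutativeRing ℚ[q]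
    constₚ-hom = record
      { ⟦_⟧    = constₚ
      ; +-homo = λ a b → ≋-refl
      ; *-homo = λ a b → ≋-cons (sym (ℚₚ.+-identityʳ (a ℚ.* b))) ≋-refl
      ; -‿homo = λ a → ≋-refl
      ; 0-homo = ≋-[]-cons refl ≋-refl
      ; 1-homo = ≋-refl }

    constₚ-≟ : ∀ a b → Maybe (constₚ a ≋ constₚ b)
    constₚ-≟ a b = dec⇒maybe (a ℚₚ.≟ b) >>= λ a≡b → just (coeffwise λ i → cong (λ x → coeff (constₚ x) i) a≡b)

  open Algebra.Solver.Ring ℚ-raw (ACR.fromCommutativeRing ℚ[q]) constₚ-hom constₚ-≟ public

ℚ-inv : (a : ℚ) → a ≢ 0ℚ → ℚ
ℚ-inv a a≢0 = (ℚ.1/ a) {{ℚ.≢-nonZero a≢0}}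

ℚ-inverseˡ : ∀ a (a≢0 : a ≢ 0ℚ) → ℚ-inv a a≢0 ℚ.* a ≡ 1ℚ
ℚ-inverseˡ a a≢0 = ℚₚ.*-inverseˡ a {{ℚ.≢-nonZero a≢0}}

ℚ-no-zero-divisors : ∀ {a b} → a ≢ 0ℚ → a ℚ.* b ≡ 0ℚ → b ≡ 0ℚ
ℚ-no-zero-divisors {a} {b} a≢0 ab≡0 = begin
  b                       ≡⟨ ℚₚ.*-identityˡ b ⟨
  1ℚ ℚ.* b                ≡⟨ cong (ℚ._* b) (ℚ-inverseˡ a a≢0) ⟨
  a⁻¹ ℚ.* a ℚ.* b         ≡⟨ ℚₚ.*-assoc a⁻¹ a b ⟩
  a⁻¹ ℚ.* (a ℚ.* b)       ≡⟨ cong (a⁻¹ ℚ.*_) ab≡0 ⟩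
  a⁻¹ ℚ.* 0ℚ              ≡⟨ ℚₚ.*-zeroʳ a⁻¹ ⟩
  0ℚ                      ∎
  where
  open ≡-Reasoning
  a⁻¹ : ℚ
  a⁻¹ = ℚ-inv a a≢0

DegreeBelow : ℕ → Poly → Set
DegreeBelow n p = ∀ i → n ≤ i → coeff p i ≡ 0ℚ

size-cons : ℚ → ℕ → ℕ
size-cons a zero with a ℚ.≟ 0ℚ
... | yes _ = 0
... | no _  = 1
size-cons a (suc k) = suc (suc k)

-- size p is deg p + 1, and 0 for the zero polynomial: the least n with
-- DegreeBelow n p (trailing zero coefficients are ignored).
size : Poly → ℕ
size []      = 0
size (a ∷ p) = size-cons a (size p)

size-vanishes : ∀ p → DegreeBelow (size p) p
size-vanishes []      i h = refl
size-vanishes (a ∷ p) i h with size p in eq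
size-vanishes (a ∷ p) zero    h | zero with a ℚ.≟ 0ℚ
... | yes a≡0 = a≡0
size-vanishes (a ∷ p) zero () | zero | no _
size-vanishes (a ∷ p) (suc i) h       | zero  = size-vanishes p i (subst (_≤ i) (sym eq) z≤n)
size-vanishes (a ∷ p) (suc i) (s≤s h) | suc k = size-vanishes p i (subst (_≤ i) (sym eq) h)

size-leading : ∀ p k → size p ≡ suc k → coeff p k ≢ 0ℚ
size-leading []      k ()
size-leading (a ∷ p) k h with size p in eq
size-leading (a ∷ p) k    h    | zero with a ℚ.≟ 0ℚ
size-leading (a ∷ p) k    ()   | zero | yes _
size-leading (a ∷ p) zero h    | zero | no a≢0 = a≢0
size-leading (a ∷ p) (suc k) refl | suc k = size-leading p k eq

size-least : ∀ p n → DegreeBelow n p → size p ≤ n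
size-least []      n       h = z≤n
size-least (a ∷ p) zero    h with size p | size-least p 0 (λ i _ → h (suc i) z≤n)
... | suc _ | ()
... | zero  | _ with a ℚ.≟ 0ℚ
...   | yes _  = z≤n
...   | no a≢0 = ⊥-elim (a≢0 (h zero z≤n))
size-least (a ∷ p) (suc n) h with size p | size-least p n (λ i le → h (suc i) (s≤s le))
... | suc _ | tail≤n = s≤s tail≤n
... | zero  | _ with a ℚ.≟ 0ℚ
...   | yes _ = z≤n
...   | no _  = s≤s z≤n

nonzero⇒<size : ∀ p i → coeff p i ≢ 0ℚ → i < size p
nonzero⇒<size p i h with i <? size p
... | yes lt = lt
... | no ¬lt = ⊥-elim (h (size-vanishes p i (≮⇒≥ ¬lt)))

size-cong : ∀ {p r} → p ≋ r → size p ≡ size r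
size-cong {p} {r} e = ≤-antisym
  (size-least p (size r) λ i le → trans (at e i) (size-vanishes r i le))
  (size-least r (size p) λ i le → trans (sym (at e i)) (size-vanishes p i le))

size≡0⇒≋[] : ∀ p → size p ≡ 0 → p ≋ []
size≡0⇒≋[] p h = coeffwise λ i → size-vanishes p i (subst (_≤ i) (sym h) z≤n)

≋[]⇒size≡0 : ∀ p → p ≋ [] → size p ≡ 0
≋[]⇒size≡0 p e = size-cong e

*ₚ-top : ∀ p r k l → DegreeBelow (suc k) p → DegreeBelow (suc l) r →
         coeff (p *ₚ r) (k + l) ≡ coeff p k ℚ.* coeff r l × DegreeBelow (suc (k + l)) (p *ₚ r)
*ₚ-top []      r k       l hp hr = sym (ℚₚ.*-zeroˡ (coeff r l)) , λ i _ → refl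
*ₚ-top (a ∷ p) r zero    l hp hr = top , above
  where
  p·r≋0 : shift (p *ₚ r) ≋ []
  p·r≋0 = ≋-[]-cons refl (*ₚ-zeroˡ p r (coeffwise λ i → hp (suc i) (s≤s z≤n)))
  a·r : ∀ i → coeff ((a ∷ p) *ₚ r) i ≡ a ℚ.* coeff r i
  a·r i = trans (coeff-*-cons a p r i)
                (trans (cong (a ℚ.* coeff r i ℚ.+_) (at p·r≋0 i)) (ℚₚ.+-identityʳ _))
  top : coeff ((a ∷ p) *ₚ r) l ≡ a ℚ.* coeff r l
  top = a·r l
  above : DegreeBelow (suc l) ((a ∷ p) *ₚ r)
  above i le = trans (a·r i) (trans (cong (a ℚ.*_) (hr i le)) (ℚₚ.*-zeroʳ a))
*ₚ-top (a ∷ p) r (suc k) l hp hr = top , above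
  where
  ih : coeff (p *ₚ r) (k + l) ≡ coeff p k ℚ.* coeff r l × DegreeBelow (suc (k + l)) (p *ₚ r)
  ih = *ₚ-top p r k l (λ i le → hp (suc i) (s≤s le)) hr
  shifted : ∀ i → l < i → coeff ((a ∷ p) *ₚ r) i ≡ coeff (shift (p *ₚ r)) i
  shifted i l<i = trans (coeff-*-cons a p r i)
    (trans (cong (ℚ._+ coeff (shift (p *ₚ r)) i) (trans (cong (a ℚ.*_) (hr i l<i)) (ℚₚ.*-zeroʳ a)))
           (ℚₚ.+-identityˡ _))
  top : coeff ((a ∷ p) *ₚ r) (suc k + l) ≡ coeff p k ℚ.* coeff r l
  top = trans (shifted (suc (k + l)) (s≤s (m≤n+m l k))) (proj₁ ih)
  above : DegreeBelow (suc (suc k + l)) ((a ∷ p) *ₚ r)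
  above (suc i) (s≤s le) =
    trans (shifted (suc i) (s≤s (≤-trans (m≤n+m l k) (≤-trans (n≤1+n _) le)))) (proj₂ ih i le)

size-*ₚ : ∀ p r k l → size p ≡ suc k → size r ≡ suc l → size (p *ₚ r) ≡ suc (k + l)
size-*ₚ p r k l sp sr = ≤-antisym
  (size-least (p *ₚ r) (suc (k + l)) (proj₂ top))
  (nonzero⇒<size (p *ₚ r) (k + l)
    (subst (_≢ 0ℚ) (sym (proj₁ top)) (ℚ-nonzero-* (size-leading p k sp) (size-leading r l sr))))
  where
  below : ∀ p k → size p ≡ suc k → DegreeBelow (suc k) p
  below p k sp i le = size-vanishes p i (subst (_≤ i) (sym sp) le)
  top : coeff (p *ₚ r) (k + l) ≡ coeff p k ℚ.* coeff r l × DegreeBelow (suc (k + l)) (p *ₚ r)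
  top = *ₚ-top p r k l (below p k sp) (below r l sr)
  ℚ-nonzero-* : ∀ {a b} → a ≢ 0ℚ → b ≢ 0ℚ → a ℚ.* b ≢ 0ℚ
  ℚ-nonzero-* a≢0 b≢0 ab≡0 = b≢0 (ℚ-no-zero-divisors a≢0 ab≡0)

nonzero-*ₚ : ∀ p r → size p ≢ 0 → size r ≢ 0 → size (p *ₚ r) ≢ 0
nonzero-*ₚ p r p≢0 r≢0 with size p in sp | size r in sr
... | zero  | _     = ⊥-elim (p≢0 refl)
... | suc _ | zero  = ⊥-elim (r≢0 refl)
... | suc k | suc l = λ e → 0≢1+n (trans (sym e) (size-*ₚ p r k l sp sr))

*ₚ-cancelˡ : ∀ z p r → size z ≢ 0 → z *ₚ p ≋ z *ₚ r → p ≋ r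
*ₚ-cancelˡ z p r z≢0 e with size (p +ₚ negₚ r) in sd
... | suc k = ⊥-elim (nonzero-*ₚ z (p +ₚ negₚ r) z≢0 (λ d≡0 → 0≢1+n (trans (sym d≡0) sd))
                        (≋[]⇒size≡0 _ z·difference≋0))
  where
  open PolySolver using (solve; _:+_; _:*_; :-_; _:=_)
  z·difference≋0 : z *ₚ (p +ₚ negₚ r) ≋ []
  z·difference≋0 = ≋-trans (expand z p r) (≋-trans (+ₚ-congˡ (negₚ (z *ₚ r)) e) (+ₚ-inverseʳ (z *ₚ r)))
    where
    expand : ∀ z p r → z *ₚ (p +ₚ negₚ r) ≋ z *ₚ p +ₚ negₚ (z *ₚ r)
    expand = solve 3 (λ z p r → z :* (p :+ :- r) := z :* p :+ :- (z :* r)) ≋-refl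
... | zero = ≋-trans (split p r) (+ₚ-congˡ r (size≡0⇒≋[] _ sd))
  where
  open PolySolver using (solve; _:+_; :-_; _:=_)
  split : ∀ p r → p ≋ (p +ₚ negₚ r) +ₚ r
  split = solve 2 (λ p r → p := (p :+ :- r) :+ r) ≋-refl

-- Divisibility in ℚ[q] with a chosen quotient; it agrees with the frozen
-- _∣ₚ_ up to wrapping the coefficientwise equation.
infix 4 _∣_
record _∣_ (d f : Poly) : Set where
  constructor divides
  field
    quotient : Poly
    equation : d *ₚ quotient ≋ f

∣-refl : ∀ d → d ∣ d
∣-refl d = divides oneₚ (*ₚ-identityʳ d)

∣-resp : ∀ {d f f′} → f ≋ f′ → d ∣ f → d ∣ f′
∣-resp e (divides g dg≋f) = divides g (≋-trans dg≋f e)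

∣-trans : ∀ {a b c} → a ∣ b → b ∣ c → a ∣ c
∣-trans {a} (divides g ag≋b) (divides h bh≋c) =
  divides (g *ₚ h) (≋-trans (≋-sym (*ₚ-assoc a g h)) (≋-trans (*ₚ-congˡ h ag≋b) bh≋c))

∣-+ₚ : ∀ {d f f′} → d ∣ f → d ∣ f′ → d ∣ f +ₚ f′
∣-+ₚ {d} (divides g dg≋f) (divides g′ dg′≋f′) =
  divides (g +ₚ g′) (≋-trans (*ₚ-distribˡ d g g′) (+ₚ-cong dg≋f dg′≋f′))

∣-*ₚˡ : ∀ {d f} h → d ∣ f → d ∣ h *ₚ f
∣-*ₚˡ {d} h (divides g dg≋f) = divides (h *ₚ g) (≋-trans (swap d h g) (*ₚ-congʳ h dg≋f))
  where
  open PolySolver using (solve; _:*_; _:=_)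
  swap : ∀ d h g → d *ₚ (h *ₚ g) ≋ h *ₚ (d *ₚ g)
  swap = solve 3 (λ d h g → d :* (h :* g) := h :* (d :* g)) ≋-refl

∣-*ₚʳ : ∀ {d f} h → d ∣ f → d ∣ f *ₚ h
∣-*ₚʳ {f = f} h d∣f = ∣-resp (*ₚ-comm h f) (∣-*ₚˡ h d∣f)

∣-cancel-+ₚ : ∀ {d a b} → d ∣ a +ₚ b → d ∣ b → d ∣ a
∣-cancel-+ₚ {d} {a} {b} d∣a+b d∣b = ∣-resp (a+b-b a b) (∣-+ₚ d∣a+b (∣-*ₚˡ (negₚ oneₚ) d∣b))
  where
  open PolySolver using (solve; _:+_; _:*_; :-_; _:=_; con)
  a+b-b : ∀ a b → (a +ₚ b) +ₚ negₚ oneₚ *ₚ b ≋ a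
  a+b-b = solve 2 (λ a b → (a :+ b) :+ (:- con 1ℚ) :* b := a) ≋-refl

constₚ-*ₚ : ∀ a b → constₚ a *ₚ constₚ b ≋ constₚ (a ℚ.* b)
constₚ-*ₚ a b = ≋-cons (ℚₚ.+-identityʳ (a ℚ.* b)) ≋-refl

constₚ-inverseˡ : ∀ c (c≢0 : c ≢ 0ℚ) → constₚ (ℚ-inv c c≢0) *ₚ constₚ c ≋ oneₚ
constₚ-inverseˡ c c≢0 = ≋-trans (constₚ-*ₚ (ℚ-inv c c≢0) c) (≋-cons (ℚ-inverseˡ c c≢0) ≋-refl)

size≡1⇒constant : ∀ p → size p ≡ 1 → p ≋ constₚ (coeff p 0) × coeff p 0 ≢ 0ℚ
size≡1⇒constant p sp =
  coeffwise (λ { zero → refl ; (suc i) → size-vanishes p (suc i) (subst (_≤ suc i) (sym sp) (s≤s z≤n)) })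
  , size-leading p 0 sp

size≡1⇒unit : ∀ u → size u ≡ 1 → u ∣ oneₚ
size≡1⇒unit u su = divides (constₚ (ℚ-inv c c≢0)) (begin
  u *ₚ constₚ (ℚ-inv c c≢0)            ≈⟨ *ₚ-comm u (constₚ (ℚ-inv c c≢0)) ⟩
  constₚ (ℚ-inv c c≢0) *ₚ u            ≈⟨ *ₚ-congʳ (constₚ (ℚ-inv c c≢0)) u≋c ⟩
  constₚ (ℚ-inv c c≢0) *ₚ constₚ c     ≈⟨ constₚ-inverseˡ c c≢0 ⟩
  oneₚ                                 ∎)
  where
  open ≋-Reasoning
  c : ℚ
  c = coeff u 0
  u≋c : u ≋ constₚ c
  u≋c = proj₁ (size≡1⇒constant u su)
  c≢0 : c ≢ 0ℚ
  c≢0 = proj₂ (size≡1⇒constant u su)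

unit⇒size≡1 : ∀ u → u ∣ oneₚ → size u ≡ 1
unit⇒size≡1 u (divides g ug≋1) = from-product (size-cong ug≋1)
  where
  from-product : size (u *ₚ g) ≡ 1 → size u ≡ 1
  from-product s≡1 with size u in su | size g in sg
  ... | zero  | _     = ⊥-elim (0≢1+n (trans (sym (≋[]⇒size≡0 _ (*ₚ-zeroˡ u g (size≡0⇒≋[] u su)))) s≡1))
  ... | suc _ | zero  = ⊥-elim (0≢1+n (trans (sym (≋[]⇒size≡0 _ u·0)) s≡1))
    where
    u·0 : u *ₚ g ≋ []
    u·0 = ≋-trans (*ₚ-comm u g) (*ₚ-zeroˡ g u (size≡0⇒≋[] g sg))
  ... | suc k | suc l = cong suc (m+n≡0⇒m≡0 k (suc-injective (trans (sym (size-*ₚ u g k l su sg)) s≡1)))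

shiftⁿ : ℕ → Poly → Poly
shiftⁿ zero    p = p
shiftⁿ (suc t) p = shift (shiftⁿ t p)

coeff-shiftⁿ : ∀ t p i → coeff (shiftⁿ t p) (t + i) ≡ coeff p i
coeff-shiftⁿ zero    p i = refl
coeff-shiftⁿ (suc t) p i = coeff-shiftⁿ t p i

shiftⁿ-degree : ∀ t p l → DegreeBelow l p → DegreeBelow (t + l) (shiftⁿ t p)
shiftⁿ-degree zero    p l h i le = h i le
shiftⁿ-degree (suc t) p l h (suc i) (s≤s le) = shiftⁿ-degree t p l h i le

shiftⁿ-*ₚ : ∀ t p r → shiftⁿ t p *ₚ r ≋ shiftⁿ t (p *ₚ r)
shiftⁿ-*ₚ zero    p r = ≋-refl
shiftⁿ-*ₚ (suc t) p r = ≋-trans (shift-*ₚ (shiftⁿ t p) r) (shift-cong (shiftⁿ-*ₚ t p r))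

q^_ : ℕ → Poly
q^ t = shiftⁿ t oneₚ

shiftⁿ-cong : ∀ t {p p′} → p ≋ p′ → shiftⁿ t p ≋ shiftⁿ t p′
shiftⁿ-cong zero    e = e
shiftⁿ-cong (suc t) e = shift-cong (shiftⁿ-cong t e)

shiftⁿ-as-*ₚ : ∀ t g → shiftⁿ t g ≋ q^ t *ₚ g
shiftⁿ-as-*ₚ t g = ≋-sym (≋-trans (shiftⁿ-*ₚ t oneₚ g) (shiftⁿ-cong t (*ₚ-identityˡ g)))

scale-as-*ₚ : ∀ a p → scale a p ≋ constₚ a *ₚ p
scale-as-*ₚ a p = ≋-sym (≋-trans (+ₚ-congʳ (scale a p) (≋-[]-cons refl ≋-refl)) (+ₚ-identityʳ (scale a p)))

add-back : ∀ f g c t → f ≋ (f +ₚ scale (ℚ.- c) (shiftⁿ t g)) +ₚ constₚ c *ₚ (q^ t *ₚ g)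
add-back f g c t = begin
  f                                                    ≈⟨ cancel f (constₚ c) (shiftⁿ t g) ⟩
  f +ₚ negₚ (constₚ c) *ₚ shiftⁿ t g +ₚ constₚ c *ₚ shiftⁿ t g
    ≈⟨ +ₚ-cong (+ₚ-congʳ f (≋-sym (scale-as-*ₚ (ℚ.- c) (shiftⁿ t g)))) (*ₚ-congʳ (constₚ c) (shiftⁿ-as-*ₚ t g)) ⟩
  (f +ₚ scale (ℚ.- c) (shiftⁿ t g)) +ₚ constₚ c *ₚ (q^ t *ₚ g) ∎
  where
  open ≋-Reasoning
  open PolySolver using (solve; _:+_; _:*_; :-_; _:=_)
  cancel : ∀ f C h → f ≋ f +ₚ negₚ C *ₚ h +ₚ C *ₚ h
  cancel = solve 3 (λ f C h → f := f :+ (:- C) :* h :+ C :* h) ≋-refl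

cancel-leading : ∀ f g k l → size f ≡ suc k → (sg : size g ≡ suc l) → l ≤ k →
  let c = coeff f k ℚ.* ℚ-inv (coeff g l) (size-leading g l sg)
  in DegreeBelow k (f +ₚ scale (ℚ.- c) (shiftⁿ (k ∸ l) g))
cancel-leading f g k l sf sg l≤k i k≤i = trans (coeff-+ f (scale (ℚ.- c) h) i)
  (trans (cong (coeff f i ℚ.+_) (coeff-scale (ℚ.- c) h i)) (vanish (m≤n⇒m<n∨m≡n k≤i)))
  where
  b b⁻¹ c : ℚ
  b   = coeff g l
  b⁻¹ = ℚ-inv b (size-leading g l sg)
  c   = coeff f k ℚ.* b⁻¹
  h : Poly
  h   = shiftⁿ (k ∸ l) g
  k∸l+l≡k : k ∸ l + l ≡ k
  k∸l+l≡k = m∸n+n≡m l≤k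
  vanish : k < i ⊎ k ≡ i → coeff f i ℚ.+ ℚ.- c ℚ.* coeff h i ≡ 0ℚ
  vanish (inj₁ k<i) = trans
    (cong₂ ℚ._+_ (size-vanishes f i (subst (_≤ i) (sym sf) k<i))
                 (trans (cong (ℚ.- c ℚ.*_) h-vanishes) (ℚₚ.*-zeroʳ (ℚ.- c))))
    (ℚₚ.+-identityʳ 0ℚ)
    where
    h-vanishes : coeff h i ≡ 0ℚ
    h-vanishes = shiftⁿ-degree (k ∸ l) g (suc l) (λ j le → size-vanishes g j (subst (_≤ j) (sym sg) le)) i
                   (subst (_≤ i) (sym (trans (+-suc (k ∸ l) l) (cong suc k∸l+l≡k))) k<i)
  vanish (inj₂ refl) = begin
    coeff f k ℚ.+ ℚ.- c ℚ.* coeff h k     ≡⟨ cong (λ j → coeff f k ℚ.+ ℚ.- c ℚ.* coeff h j) k∸l+l≡k ⟨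
    coeff f k ℚ.+ ℚ.- c ℚ.* coeff h (k ∸ l + l) ≡⟨ cong (λ x → coeff f k ℚ.+ ℚ.- c ℚ.* x) (coeff-shiftⁿ (k ∸ l) g l) ⟩
    coeff f k ℚ.+ ℚ.- c ℚ.* b             ≡⟨ cong (coeff f k ℚ.+_) (ℚₚ.neg-distribˡ-* c b) ⟨
    coeff f k ℚ.+ ℚ.- (c ℚ.* b)           ≡⟨ cong (λ x → coeff f k ℚ.+ ℚ.- x) (ℚₚ.*-assoc (coeff f k) b⁻¹ b) ⟩
    coeff f k ℚ.+ ℚ.- (coeff f k ℚ.* (b⁻¹ ℚ.* b)) ≡⟨ cong (λ x → coeff f k ℚ.+ ℚ.- (coeff f k ℚ.* x)) (ℚ-inverseˡ b (size-leading g l sg)) ⟩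
    coeff f k ℚ.+ ℚ.- (coeff f k ℚ.* 1ℚ)  ≡⟨ cong (λ x → coeff f k ℚ.+ ℚ.- x) (ℚₚ.*-identityʳ (coeff f k)) ⟩
    coeff f k ℚ.+ ℚ.- coeff f k           ≡⟨ ℚₚ.+-inverseʳ (coeff f k) ⟩
    0ℚ                                    ∎
    where open ≡-Reasoning

record Division (f g : Poly) : Set where
  constructor division
  field
    quot rem  : Poly
    identity  : f ≋ quot *ₚ g +ₚ rem
    rem-small : size rem < size g

-- Division with remainder by a nonzero polynomial, by induction on an
-- upper bound for the size of the dividend: while f is not smaller than g,
-- cancel its leading coefficient and recurse.
divide : ∀ f g → size g ≢ 0 → Division f g
divide f g g≢0 with size g in sg
... | zero  = ⊥-elim (g≢0 refl)
... | suc l = reduce (size f) f ≤-refl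
  where
  open PolySolver using (solve; _:+_; _:*_; _:=_)
  reduce : ∀ n f → size f ≤ n → Division f g
  reduce n f sf with size f ≤? l
  ... | yes small = division [] f ≋-refl (subst (size f <_) (sym sg) (s≤s small))
  reduce zero    f sf | no big = ⊥-elim (big (≤-trans sf z≤n))
  reduce (suc n) f sf | no big with size f in sf′
  ... | zero  = ⊥-elim (big z≤n)
  ... | suc k = division (quot +ₚ C *ₚ q^ t) rem f≋ rem-small
    where
    l≤k : l ≤ k
    l≤k = ≤-pred (≰⇒> big)
    t : ℕ
    t   = k ∸ l
    c : ℚ
    c   = coeff f k ℚ.* ℚ-inv (coeff g l) (size-leading g l sg)
    C f′ : Poly
    C   = constₚ c
    f′  = f +ₚ scale (ℚ.- c) (shiftⁿ t g)
    f′-small : size f′ ≤ n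
    f′-small = ≤-trans (size-least f′ k (cancel-leading f g k l sf′ sg l≤k)) (≤-pred sf)
    open Division (reduce n f′ f′-small)
    f≋ : f ≋ (quot +ₚ C *ₚ q^ t) *ₚ g +ₚ rem
    f≋ = begin
      f                                      ≈⟨ add-back f g c t ⟩
      f′ +ₚ C *ₚ (q^ t *ₚ g)                  ≈⟨ +ₚ-congˡ (C *ₚ (q^ t *ₚ g)) identity ⟩
      quot *ₚ g +ₚ rem +ₚ C *ₚ (q^ t *ₚ g)     ≈⟨ collect quot g rem C (q^ t) ⟩
      (quot +ₚ C *ₚ q^ t) *ₚ g +ₚ rem          ∎
      where
      open ≋-Reasoning
      collect : ∀ Q g R C T → Q *ₚ g +ₚ R +ₚ C *ₚ (T *ₚ g) ≋ (Q +ₚ C *ₚ T) *ₚ g +ₚ R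
      collect = solve 5 (λ Q g R C T → Q :* g :+ R :+ C :* (T :* g) := (Q :+ C :* T) :* g :+ R) ≋-refl

record BezoutGcd (a b : Poly) : Set where
  constructor bezoutGcd
  field
    gcd A B     : Poly
    combination : gcd ≋ A *ₚ a +ₚ B *ₚ b
    gcd∣a       : gcd ∣ a
    gcd∣b       : gcd ∣ b

euclid : ∀ a b → BezoutGcd a b
euclid a b = go (size b) a b ≤-refl
  where
  open PolySolver using (solve; _:+_; _:*_; :-_; _:=_)
  go : ∀ n a b → size b ≤ n → BezoutGcd a b
  go n a b sb with size b in sb′
  ... | zero = bezoutGcd a oneₚ [] (≋-sym (≋-trans (+ₚ-identityʳ (oneₚ *ₚ a)) (*ₚ-identityˡ a)))
                         (∣-refl a) (divides [] (≋-trans (*ₚ-zeroʳ a) (≋-sym (size≡0⇒≋[] b sb′))))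
  go zero    a b () | suc _
  go (suc n) a b sb | suc l with divide a b (λ b≡0 → 0≢1+n (trans (sym b≡0) sb′))
  ... | division Q R a≋ R<b with go n b R (≤-pred (≤-trans (subst (size R <_) sb′ R<b) sb))
  ...   | bezoutGcd g A B g≋ g∣b g∣R = bezoutGcd g B (A +ₚ negₚ (B *ₚ Q)) g≋′ g∣a g∣b
    where
    g∣a : g ∣ a
    g∣a = ∣-resp (≋-sym a≋) (∣-+ₚ (∣-*ₚˡ Q g∣b) g∣R)
    g≋′ : g ≋ B *ₚ a +ₚ (A +ₚ negₚ (B *ₚ Q)) *ₚ b
    g≋′ = ≋-trans g≋ (≋-trans (rearrange A B b Q R) (+ₚ-congˡ _ (*ₚ-congʳ B (≋-sym a≋))))
      where
      rearrange : ∀ A B b Q R → A *ₚ b +ₚ B *ₚ R ≋ B *ₚ (Q *ₚ b +ₚ R) +ₚ (A +ₚ negₚ (B *ₚ Q)) *ₚ b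
      rearrange = solve 5 (λ A B b Q R → A :* b :+ B :* R := B :* (Q :* b :+ R) :+ (A :+ :- (B :* Q)) :* b) ≋-refl

record Coprime (p f : Poly) : Set where
  constructor coprime
  field
    A B    : Poly
    bezout : A *ₚ p +ₚ B *ₚ f ≋ oneₚ

record ProperFactor (p : Poly) : Set where
  constructor properFactor
  field
    factor   : Poly
    factor∣p : factor ∣ p
    nonunit  : 2 ≤ size factor
    smaller  : size factor < size p

size-factors : ∀ g h p → g *ₚ h ≋ p → size p ≢ 0 →
               Σ ℕ λ a → Σ ℕ λ b → size g ≡ suc a × size h ≡ suc b × size p ≡ suc (a + b)
size-factors g h p gh≋p p≢0 with size g in sg | size h in sh
... | zero  | _    = ⊥-elim (p≢0 (trans (sym (size-cong gh≋p)) (≋[]⇒size≡0 _ (*ₚ-zeroˡ g h (size≡0⇒≋[] g sg)))))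
... | suc _ | zero = ⊥-elim (p≢0 (trans (sym (size-cong gh≋p)) (≋[]⇒size≡0 _ gh≋0)))
  where
  gh≋0 : g *ₚ h ≋ []
  gh≋0 = ≋-trans (*ₚ-comm g h) (*ₚ-zeroˡ h g (size≡0⇒≋[] h sh))
... | suc a | suc b = a , b , refl , refl , trans (sym (size-cong gh≋p)) (size-*ₚ g h a b sg sh)

≥2⇒≢0 : ∀ {n} → 2 ≤ n → n ≢ 0
≥2⇒≢0 (s≤s _) ()

-- For a non-unit p and any f, the gcd of p and f is either a unit (p, f
-- coprime), or p itself up to a unit (p divides f), or a proper factor of p.
trichotomy : ∀ p f → 2 ≤ size p → p ∣ f ⊎ Coprime p f ⊎ ProperFactor p
trichotomy p f 2≤p with euclid p f
... | bezoutGcd g A B g≋ g∣p g∣f with g∣p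
...   | divides h gh≋p with size-factors g h p gh≋p (≥2⇒≢0 2≤p)
...     | zero , b , sg , sh , _ = inj₂ (inj₁ (coprime (w *ₚ A) (w *ₚ B) bezout))
  where
  open PolySolver using (solve; _:+_; _:*_; _:=_)
  w : Poly
  w = _∣_.quotient (size≡1⇒unit g sg)
  bezout : (w *ₚ A) *ₚ p +ₚ (w *ₚ B) *ₚ f ≋ oneₚ
  bezout = ≋-trans (factor-out w A p B f)
    (≋-trans (*ₚ-congʳ w (≋-sym g≋)) (≋-trans (*ₚ-comm w g) (_∣_.equation (size≡1⇒unit g sg))))
    where
    factor-out : ∀ w A p B f → (w *ₚ A) *ₚ p +ₚ (w *ₚ B) *ₚ f ≋ w *ₚ (A *ₚ p +ₚ B *ₚ f)
    factor-out = solve 5 (λ w A p B f → (w :* A) :* p :+ (w :* B) :* f := w :* (A :* p :+ B :* f)) ≋-refl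
...     | suc a , zero , sg , sh , _ = inj₁ (∣-trans p∣g g∣f)
  where
  w : Poly
  w = _∣_.quotient (size≡1⇒unit h sh)
  p∣g : p ∣ g
  p∣g = divides w (begin
    p *ₚ w            ≈⟨ *ₚ-congˡ w (≋-sym gh≋p) ⟩
    g *ₚ h *ₚ w       ≈⟨ *ₚ-assoc g h w ⟩
    g *ₚ (h *ₚ w)     ≈⟨ *ₚ-congʳ g (_∣_.equation (size≡1⇒unit h sh)) ⟩
    g *ₚ oneₚ         ≈⟨ *ₚ-identityʳ g ⟩
    g                 ∎)
    where open ≋-Reasoning
...     | suc a , suc b , sg , sh , sp = inj₂ (inj₂ (properFactor g g∣p 2≤g g<p))
  where
  2≤g : 2 ≤ size g
  2≤g = subst (2 ≤_) (sym sg) (s≤s (s≤s z≤n))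
  g<p : size g < size p
  g<p = subst₂ _<_ (sym sg) (sym sp) (s≤s (s≤s (subst (suc a ≤_) (sym (+-suc a b)) (s≤s (m≤m+n a b)))))

coprime-divisor⇒unit : ∀ {p f} → p ∣ f → Coprime p f → p ∣ oneₚ
coprime-divisor⇒unit {p} p∣f (coprime A B bezout) =
  ∣-resp bezout (∣-+ₚ (∣-*ₚˡ A (∣-refl p)) (∣-*ₚˡ B p∣f))

coprime-oneₚ : ∀ p → Coprime p oneₚ
coprime-oneₚ p = coprime [] oneₚ (*ₚ-identityˡ oneₚ)

coprime-*ₚ : ∀ {p f g} → Coprime p f → Coprime p g → Coprime p (f *ₚ g)
coprime-*ₚ {p} {f} {g} (coprime A B bezout) (coprime A′ B′ bezout′) =
  coprime (A *ₚ A′ *ₚ p +ₚ A *ₚ B′ *ₚ g +ₚ B *ₚ f *ₚ A′) (B *ₚ B′)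
          (≋-trans (expand A B A′ B′ p f g) (≋-trans (*ₚ-cong bezout bezout′) (*ₚ-identityˡ oneₚ)))
  where
  open PolySolver using (solve; _:+_; _:*_; _:=_)
  expand : ∀ A B A′ B′ p f g →
    (A *ₚ A′ *ₚ p +ₚ A *ₚ B′ *ₚ g +ₚ B *ₚ f *ₚ A′) *ₚ p +ₚ (B *ₚ B′) *ₚ (f *ₚ g)
      ≋ (A *ₚ p +ₚ B *ₚ f) *ₚ (A′ *ₚ p +ₚ B′ *ₚ g)
  expand = solve 7 (λ A B A′ B′ p f g →
    (A :* A′ :* p :+ A :* B′ :* g :+ B :* f :* A′) :* p :+ (B :* B′) :* (f :* g)
      := (A :* p :+ B :* f) :* (A′ :* p :+ B′ :* g)) ≋-refl

coprime-to-nonzero-constant : ∀ {p E f H} c → c ≢ 0ℚ → p ∣ E → f ≋ constₚ c +ₚ E *ₚ H → Coprime p f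
coprime-to-nonzero-constant {p} {E} {f} {H} c c≢0 (divides w pw≋E) f≋ =
  coprime (negₚ (c⁻¹ *ₚ (w *ₚ H))) c⁻¹ (begin
    negₚ (c⁻¹ *ₚ (w *ₚ H)) *ₚ p +ₚ c⁻¹ *ₚ f
      ≈⟨ +ₚ-congʳ (negₚ (c⁻¹ *ₚ (w *ₚ H)) *ₚ p) (*ₚ-congʳ c⁻¹ (≋-trans f≋ (+ₚ-congʳ (constₚ c) (*ₚ-congˡ H (≋-sym pw≋E))))) ⟩
    negₚ (c⁻¹ *ₚ (w *ₚ H)) *ₚ p +ₚ c⁻¹ *ₚ (constₚ c +ₚ (p *ₚ w) *ₚ H)
      ≈⟨ cancel c⁻¹ p (constₚ c) w H ⟩
    c⁻¹ *ₚ constₚ c ≈⟨ constₚ-inverseˡ c c≢0 ⟩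
    oneₚ ∎)
  where
  open ≋-Reasoning
  open PolySolver using (solve; _:+_; _:*_; :-_; _:=_)
  c⁻¹ : Poly
  c⁻¹ = constₚ (ℚ-inv c c≢0)
  cancel : ∀ C p c w H → negₚ (C *ₚ (w *ₚ H)) *ₚ p +ₚ C *ₚ (c +ₚ (p *ₚ w) *ₚ H) ≋ C *ₚ c
  cancel = solve 5 (λ C p c w H → (:- (C :* (w :* H))) :* p :+ C :* (c :+ (p :* w) :* H) := C :* c) ≋-refl

extend-below : ∀ {P : ℕ → Set} K → (∀ k → k < K → P k) → P K → ∀ k → k < suc K → P k
extend-below K below at-K k (s≤s k≤K) with m≤n⇒m<n∨m≡n k≤K
... | inj₁ k<K  = below k k<K
... | inj₂ refl = at-K

scan : ∀ {P Q : ℕ → Set} n → (∀ k → k < n → P k ⊎ Q k) →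
       (Σ ℕ λ e → P e × (∀ k → k < e → Q k)) ⊎ (∀ k → k < n → Q k)
scan zero    decide = inj₂ λ k ()
scan (suc n) decide with scan n (λ k k<n → decide k (≤-trans k<n (n≤1+n n)))
... | inj₁ found = inj₁ found
... | inj₂ Q-below with decide n ≤-refl
...   | inj₁ P-n = inj₁ (n , P-n , Q-below)
...   | inj₂ Q-n = inj₂ (extend-below n Q-below Q-n)

least-witness : ∀ {P Q : ℕ → Set} N → (∀ k → k < N → P k ⊎ Q k) → P N →
                Σ ℕ λ e → P e × (∀ k → k < e → Q k)
least-witness N decide P-N with scan N decide
... | inj₁ found   = found
... | inj₂ Q-below = N , P-N , Q-below

-- This is our constructive substitute for an irreducible factor: we
-- cannot decide irreducibility, but only finitely many F k matter.
record Decisive (F : ℕ → Poly) (K : ℕ) (p : Poly) : Set where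
  constructor decisive
  field
    nonunit : 2 ≤ size p
    decides : ∀ k → k < K → p ∣ F k ⊎ Coprime p (F k)

decide-all : ∀ F K p → 2 ≤ size p → Decisive F K p ⊎ ProperFactor p
decide-all F zero    p 2≤p = inj₁ (decisive 2≤p λ k ())
decide-all F (suc K) p 2≤p with decide-all F K p 2≤p
... | inj₂ factor = inj₂ factor
... | inj₁ (decisive _ below) with trichotomy p (F K) 2≤p
...   | inj₁ p∣FK            = inj₁ (decisive 2≤p (extend-below K below (inj₁ p∣FK)))
...   | inj₂ (inj₁ coprimeK) = inj₁ (decisive 2≤p (extend-below K below (inj₂ coprimeK)))
...   | inj₂ (inj₂ factor)   = inj₂ factor

-- Every non-unit d has a decisive factor: descend along proper factors,
-- whose sizes strictly decrease.
decisive-factor : ∀ F K d → 2 ≤ size d → Σ Poly λ p → p ∣ d × Decisive F K p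
decisive-factor F K d 2≤d = descend (size d) d ≤-refl 2≤d
  where
  descend : ∀ n p → size p ≤ n → 2 ≤ size p → Σ Poly λ p′ → p′ ∣ p × Decisive F K p′
  descend n p sp 2≤p with decide-all F K p 2≤p
  ... | inj₁ p-decisive = p , ∣-refl p , p-decisive
  descend zero    p sp 2≤p | inj₂ _ = ⊥-elim (≥2⇒≢0 2≤p (n≤0⇒n≡0 sp))
  descend (suc n) p sp 2≤p | inj₂ (properFactor g g∣p 2≤g g<p)
    with descend n g (≤-pred (≤-trans g<p sp)) 2≤g
  ... | p′ , p′∣g , p′-decisive = p′ , ∣-trans p′∣g g∣p , p′-decisive

shift-as-*ₚ : ∀ r → shift r ≋ q^ 1 *ₚ r
shift-as-*ₚ r = ≋-sym (≋-trans (shift-*ₚ oneₚ r) (shift-cong (*ₚ-identityˡ r)))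

qint-suc : ∀ n → qint (suc n) ≋ oneₚ +ₚ q^ 1 *ₚ qint n
qint-suc n = ≋-trans (≋-cons (sym (ℚₚ.+-identityʳ 1ℚ)) ≋-refl) (+ₚ-congʳ oneₚ (shift-as-*ₚ (qint n)))

qint-+ : ∀ a b → qint (a + b) ≋ qint a +ₚ q^ a *ₚ qint b
qint-+ zero    b = ≋-sym (*ₚ-identityˡ (qint b))
qint-+ (suc a) b = begin
  qint (suc a + b)                           ≈⟨ qint-suc (a + b) ⟩
  oneₚ +ₚ q^ 1 *ₚ qint (a + b)               ≈⟨ +ₚ-congʳ oneₚ (*ₚ-congʳ (q^ 1) (qint-+ a b)) ⟩
  oneₚ +ₚ q^ 1 *ₚ (qint a +ₚ q^ a *ₚ qint b) ≈⟨ regroup (q^ 1) (qint a) (q^ a) (qint b) ⟩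
  (oneₚ +ₚ q^ 1 *ₚ qint a) +ₚ (q^ 1 *ₚ q^ a) *ₚ qint b
    ≈⟨ +ₚ-cong (≋-sym (qint-suc a)) (*ₚ-congˡ (qint b) (≋-sym (shift-as-*ₚ (q^ a)))) ⟩
  qint (suc a) +ₚ q^ (suc a) *ₚ qint b       ∎
  where
  open ≋-Reasoning
  open PolySolver using (solve; _:+_; _:*_; _:=_; con)
  regroup : ∀ X qa pa qb → oneₚ +ₚ X *ₚ (qa +ₚ pa *ₚ qb) ≋ (oneₚ +ₚ X *ₚ qa) +ₚ (X *ₚ pa) *ₚ qb
  regroup = solve 4 (λ X qa pa qb → con 1ℚ :+ X :* (qa :+ pa :* qb) := (con 1ℚ :+ X :* qa) :+ (X :* pa) :* qb) ≋-refl

q-1 : Poly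
q-1 = q^ 1 +ₚ negₚ oneₚ

q^-via-qint : ∀ n → q^ n ≋ oneₚ +ₚ q-1 *ₚ qint n
q^-via-qint zero    = ≋-sym (≋-trans (+ₚ-congʳ oneₚ (*ₚ-zeroʳ q-1)) (+ₚ-identityʳ oneₚ))
q^-via-qint (suc n) = begin
  q^ (suc n)                                   ≈⟨ shift-as-*ₚ (q^ n) ⟩
  q^ 1 *ₚ q^ n                                 ≈⟨ *ₚ-congʳ (q^ 1) (q^-via-qint n) ⟩
  q^ 1 *ₚ (oneₚ +ₚ q-1 *ₚ qint n)              ≈⟨ expand (q^ 1) (qint n) ⟩
  oneₚ +ₚ q-1 *ₚ (oneₚ +ₚ q^ 1 *ₚ qint n)      ≈⟨ +ₚ-congʳ oneₚ (*ₚ-congʳ q-1 (≋-sym (qint-suc n))) ⟩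
  oneₚ +ₚ q-1 *ₚ qint (suc n)                  ∎
  where
  open ≋-Reasoning
  open PolySolver using (solve; _:+_; _:*_; _:-_; _:=_; con)
  expand : ∀ X Q → X *ₚ (oneₚ +ₚ (X +ₚ negₚ oneₚ) *ₚ Q) ≋ oneₚ +ₚ (X +ₚ negₚ oneₚ) *ₚ (oneₚ +ₚ X *ₚ Q)
  expand = solve 2 (λ X Q → X :* (con 1ℚ :+ (X :- con 1ℚ) :* Q) := con 1ℚ :+ (X :- con 1ℚ) :* (con 1ℚ :+ X :* Q)) ≋-refl

-- q is invertible modulo [N + 1]: q^N·q = 1 + (q - 1)[N + 1].  Hence a
-- divisor p of [N + 1] dividing q^a·h also divides h.
cancel-q^ : ∀ {p} N a h → p ∣ qint (suc N) → p ∣ q^ a *ₚ h → p ∣ h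
cancel-q^         N zero    h p∣[N+1] p∣h = ∣-resp (*ₚ-identityˡ h) p∣h
cancel-q^ {p} N (suc a) h p∣[N+1] p∣q·q^a·h =
  cancel-q^ N a h p∣[N+1] (∣-cancel-+ₚ (∣-resp expand (∣-*ₚˡ (q^ N) p∣q·q^a·h)) p∣rest)
  where
  open PolySolver using (solve; _:+_; _:*_; _:=_)
  g rest : Poly
  g    = q^ a *ₚ h
  rest = q-1 *ₚ qint (suc N) *ₚ g
  p∣rest : p ∣ rest
  p∣rest = ∣-*ₚʳ g (∣-*ₚˡ q-1 p∣[N+1])
  expand : q^ N *ₚ (q^ (suc a) *ₚ h) ≋ g +ₚ rest
  expand = begin
    q^ N *ₚ (q^ (suc a) *ₚ h)   ≈⟨ *ₚ-congʳ (q^ N) (*ₚ-congˡ h (shift-as-*ₚ (q^ a))) ⟩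
    q^ N *ₚ (q^ 1 *ₚ q^ a *ₚ h) ≈⟨ reassoc (q^ N) (q^ 1) (q^ a) h ⟩
    (q^ 1 *ₚ q^ N) *ₚ g         ≈⟨ *ₚ-congˡ g (≋-trans (≋-sym (shift-as-*ₚ (q^ N))) (q^-via-qint (suc N))) ⟩
    (oneₚ +ₚ q-1 *ₚ qint (suc N)) *ₚ g ≈⟨ distribute (q-1 *ₚ qint (suc N)) g ⟩
    g +ₚ rest                   ∎
    where
    open ≋-Reasoning
    reassoc : ∀ a b c h → a *ₚ (b *ₚ c *ₚ h) ≋ (b *ₚ a) *ₚ (c *ₚ h)
    reassoc = solve 4 (λ a b c h → a :* (b :* c :* h) := (b :* a) :* (c :* h)) ≋-refl
    distribute : ∀ E g → (oneₚ +ₚ E) *ₚ g ≋ g +ₚ E *ₚ g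
    distribute E g = ≋-trans (*ₚ-distribʳ oneₚ E g) (+ₚ-congˡ (E *ₚ g) (*ₚ-identityˡ g))

qint-difference : ∀ {p} N a b → p ∣ qint (suc N) → p ∣ qint a → p ∣ qint (a + b) → p ∣ qint b
qint-difference {p} N a b p∣[N+1] p∣[a] p∣[a+b] = cancel-q^ N a (qint b) p∣[N+1]
  (∣-cancel-+ₚ (∣-resp (≋-trans (qint-+ a b) (+ₚ-comm (qint a) _)) p∣[a+b]) p∣[a])

geom : ℕ → ℕ → Poly
geom e zero    = []
geom e (suc j) = oneₚ +ₚ q^ e *ₚ geom e j

qint-multiple : ∀ e j → qint (j * e) ≋ qint e *ₚ geom e j
qint-multiple e zero    = ≋-sym (*ₚ-zeroʳ (qint e))
qint-multiple e (suc j) = begin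
  qint (e + j * e)                        ≈⟨ qint-+ e (j * e) ⟩
  qint e +ₚ q^ e *ₚ qint (j * e)          ≈⟨ +ₚ-congʳ (qint e) (*ₚ-congʳ (q^ e) (qint-multiple e j)) ⟩
  qint e +ₚ q^ e *ₚ (qint e *ₚ geom e j)  ≈⟨ factor-out (qint e) (q^ e) (geom e j) ⟩
  qint e *ₚ geom e (suc j)                ∎
  where
  open ≋-Reasoning
  open PolySolver using (solve; _:+_; _:*_; _:=_; con)
  factor-out : ∀ E P G → E +ₚ P *ₚ (E *ₚ G) ≋ E *ₚ (oneₚ +ₚ P *ₚ G)
  factor-out = solve 3 (λ E P G → E :+ P :* (E :* G) := E :* (con 1ℚ :+ P :* G)) ≋-refl

ℕ→ℚ : ℕ → ℚ
ℕ→ℚ zero    = 0ℚ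
ℕ→ℚ (suc j) = 1ℚ ℚ.+ ℕ→ℚ j

ℕ→ℚ-suc≢0 : ∀ j → ℕ→ℚ (suc j) ≢ 0ℚ
ℕ→ℚ-suc≢0 j e = ℚₚ.<-irrefl (sym e) (ℚₚ.positive⁻¹ (ℕ→ℚ (suc j)) {{positive j}})
  where
  nonNegative : ∀ j → ℚ.NonNegative (ℕ→ℚ j)
  nonNegative zero    = _
  nonNegative (suc j) = ℚₚ.nonNeg+nonNeg⇒nonNeg 1ℚ {{_}} (ℕ→ℚ j) {{nonNegative j}}
  positive : ∀ j → ℚ.Positive (ℕ→ℚ (suc j))
  positive j = ℚₚ.pos+nonNeg⇒pos 1ℚ {{_}} (ℕ→ℚ j) {{nonNegative j}}

-- Since q^e ≡ 1 modulo [e], geom e j ≡ j modulo [e].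
geom-mod-qint : ∀ e j → Σ Poly λ H → geom e j ≋ constₚ (ℕ→ℚ j) +ₚ qint e *ₚ H
geom-mod-qint e zero    = [] , ≋-sym (≋-trans (+ₚ-congʳ (constₚ 0ℚ) (*ₚ-zeroʳ (qint e))) (≋-[]-cons refl ≋-refl))
geom-mod-qint e (suc j) with geom-mod-qint e j
... | H , geom≋ = q-1 *ₚ C +ₚ q^ e *ₚ H , (begin
  oneₚ +ₚ q^ e *ₚ geom e j                          ≈⟨ +ₚ-congʳ oneₚ (*ₚ-cong (q^-via-qint e) geom≋) ⟩
  oneₚ +ₚ (oneₚ +ₚ q-1 *ₚ E) *ₚ (C +ₚ E *ₚ H)       ≈⟨ regroup q-1 E C H ⟩
  (oneₚ +ₚ C) +ₚ E *ₚ (q-1 *ₚ C +ₚ (oneₚ +ₚ q-1 *ₚ E) *ₚ H)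
    ≈⟨ +ₚ-congʳ (oneₚ +ₚ C) (*ₚ-congʳ E (+ₚ-congʳ (q-1 *ₚ C) (*ₚ-congˡ H (≋-sym (q^-via-qint e))))) ⟩
  constₚ (ℕ→ℚ (suc j)) +ₚ E *ₚ (q-1 *ₚ C +ₚ q^ e *ₚ H) ∎)
  where
  open ≋-Reasoning
  open PolySolver using (solve; _:+_; _:*_; _:=_; con)
  C E : Poly
  C = constₚ (ℕ→ℚ j)
  E = qint e
  regroup : ∀ Y E C H → oneₚ +ₚ (oneₚ +ₚ Y *ₚ E) *ₚ (C +ₚ E *ₚ H) ≋ (oneₚ +ₚ C) +ₚ E *ₚ (Y *ₚ C +ₚ (oneₚ +ₚ Y *ₚ E) *ₚ H)
  regroup = solve 4 (λ Y E C H → con 1ℚ :+ (con 1ℚ :+ Y :* E) :* (C :+ E :* H) := (con 1ℚ :+ C) :+ E :* (Y :* C :+ (con 1ℚ :+ Y :* E) :* H)) ≋-refl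

multiples : ℕ → ℕ → ℕ
multiples e zero = 0
multiples e (suc k) with e ∣? suc k
... | yes _ = suc (multiples e k)
... | no _  = multiples e k

multiples-step-∣ : ∀ e k → e ∣ℕ suc k → multiples e (suc k) ≡ suc (multiples e k)
multiples-step-∣ e k e∣k+1 with e ∣? suc k
... | yes _   = refl
... | no e∤k+1 = ⊥-elim (e∤k+1 e∣k+1)

multiples-step-∤ : ∀ e k → ¬ e ∣ℕ suc k → multiples e (suc k) ≡ multiples e k
multiples-step-∤ e k e∤k+1 with e ∣? suc k
... | yes e∣k+1 = ⊥-elim (e∤k+1 e∣k+1)
... | no _      = refl

multiples-small : ∀ e r → r < e → multiples e r ≡ 0
multiples-small e zero    _   = refl
multiples-small e (suc r) r<e with e ∣? suc r
... | yes e∣r = ⊥-elim (<⇒≱ r<e (∣⇒≤ e∣r))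
... | no _    = multiples-small e r (≤-trans (n≤1+n (suc r)) r<e)

multiples-+ : ∀ e x → 1 ≤ e → multiples e (x + e) ≡ suc (multiples e x)
multiples-+ (suc e) zero    _ with suc e ∣? suc e
... | yes _   = cong suc (multiples-small (suc e) e ≤-refl)
... | no e∤e  = ⊥-elim (e∤e ∣ℕ-refl)
multiples-+ e       (suc x) 1≤e with e ∣? suc (x + e) | e ∣? suc x
... | yes _   | yes _   = cong suc (multiples-+ e x 1≤e)
... | no _    | no _    = multiples-+ e x 1≤e
... | yes e∣  | no e∤x  = ⊥-elim (e∤x (∣m+n∣m⇒∣n (subst (e ∣ℕ_) (+-comm (suc x) e) e∣) ∣ℕ-refl))
... | no e∤   | yes e∣x = ⊥-elim (e∤ (∣m∣n⇒∣m+n e∣x ∣ℕ-refl))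

multiples-linear : ∀ e t u → 1 ≤ e → multiples e (t * e + u) ≡ t + multiples e u
multiples-linear e zero    u _   = refl
multiples-linear e (suc t) u 1≤e = begin
  multiples e (suc t * e + u)       ≡⟨ cong (multiples e) (reorder t u e) ⟩
  multiples e ((t * e + u) + e)     ≡⟨ multiples-+ e (t * e + u) 1≤e ⟩
  suc (multiples e (t * e + u))     ≡⟨ cong suc (multiples-linear e t u 1≤e) ⟩
  suc t + multiples e u             ∎
  where
  open ≡-Reasoning
  open NatSolver using (solve; _:+_; _:*_; _:=_; con)
  reorder : ∀ t u e → suc t * e + u ≡ (t * e + u) + e
  reorder = solve 3 (λ t u e → (con 1 :+ t) :* e :+ u := (t :* e :+ u) :+ e) refl

multiples-one : ∀ e u → 1 ≤ e → e ≤ u → u < e + e → multiples e u ≡ 1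
multiples-one e u 1≤e e≤u u<2e = begin
  multiples e u                   ≡⟨ cong (multiples e) (m∸n+n≡m e≤u) ⟨
  multiples e (u ∸ e + e)         ≡⟨ multiples-+ e (u ∸ e) 1≤e ⟩
  suc (multiples e (u ∸ e))       ≡⟨ cong suc (multiples-small e (u ∸ e) u∸e<e) ⟩
  1                               ∎
  where
  open ≡-Reasoning
  u∸e<e : u ∸ e < e
  u∸e<e = +-cancelʳ-< e (u ∸ e) e (subst (_< e + e) (sym (m∸n+n≡m e≤u)) u<2e)

-- If 2r + 1 = e and s < e, then r + s and s + s carry over e alike:
-- both are < e when s ≤ r, and both lie in [e, 2e) when r < s.
carries-agree : ∀ {e} r s → suc (r + r) ≡ e → s < e → multiples e (s + s) ≡ multiples e (r + s)
carries-agree r s refl s<e with s ≤? r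
... | yes s≤r = trans (multiples-small _ (s + s) (s≤s (+-mono-≤ s≤r s≤r)))
                      (sym (multiples-small _ (r + s) (s≤s (+-monoʳ-≤ r s≤r))))
... | no s≰r = trans (multiples-one _ (s + s) (s≤s z≤n) (+-mono-≤ r<s (<⇒≤ r<s)) (+-mono-< s<e s<e))
                     (sym (multiples-one _ (r + s) (s≤s z≤n) e≤r+s (+-mono-< r<e s<e)))
  where
  r<s : r < s
  r<s = ≰⇒> s≰r
  r<e : r < suc (r + r)
  r<e = s≤s (m≤m+n r r)
  e≤r+s : suc (r + r) ≤ r + s
  e≤r+s = ≤-trans (≤-reflexive (sym (+-suc r r))) (+-monoʳ-≤ r r<s)

odd-residue : ∀ e a r → r < e → e ∣ℕ 2 * (a * e + r) + 1 → suc (r + r) ≡ e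
odd-residue e a r r<e e∣ = quotient-one (∣m+n∣m⇒∣n (subst (e ∣ℕ_) (regroup a r e) e∣) (n∣m*n (2 * a)))
  where
  open NatSolver using (solve; _:+_; _:*_; _:=_; con)
  regroup : ∀ a r e → 2 * (a * e + r) + 1 ≡ (2 * a) * e + suc (r + r)
  regroup = solve 3 (λ a r e → con 2 :* (a :* e :+ r) :+ con 1 := (con 2 :* a) :* e :+ (con 1 :+ (r :+ r))) refl
  -- 0 < 2r + 1 < 2e, so the quotient is 1
  quotient-one : e ∣ℕ suc (r + r) → suc (r + r) ≡ e
  quotient-one (divides zero ())
  quotient-one (divides (suc zero) eq) = trans eq (+-identityʳ e)
  quotient-one (divides (suc (suc t)) eq) = ⊥-elim (<⇒≱ 2r+1<2e (begin
    e + e                 ≤⟨ m≤m+n (e + e) (t * e) ⟩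
    e + e + t * e         ≡⟨ +-assoc e e (t * e) ⟩
    suc (suc t) * e       ≡⟨ eq ⟨
    suc (r + r)           ∎))
    where
    open ≤-Reasoning
    2r+1<2e : suc (r + r) < e + e
    2r+1<2e = subst (_≤ e + e) (cong suc (+-suc r r)) (+-mono-≤ r<e r<e)

euclidean-division : ∀ m e .{{_ : NonZero e}} → m ≡ m / e * e + m % e
euclidean-division m e = trans (m≡m%n+[m/n]*n m e) (+-comm (m % e) (m / e * e))

multiples-balance : ∀ e m n → 1 ≤ e → e ∣ℕ 2 * m + 1 →
  multiples e (2 * m) + multiples e (2 * n) ≡ multiples e (m + n) + multiples e m + multiples e n
multiples-balance e@(suc _) m n 1≤e e∣2m+1 = begin
  M (2 * m) + M (2 * n)                   ≡⟨ cong₂ _+_ M2m M2n ⟩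
  2 * a + (2 * b + M (s + s))             ≡⟨ cong (λ x → 2 * a + (2 * b + x)) (carries-agree r s 2r+1≡e s<e) ⟩
  2 * a + (2 * b + M (r + s))             ≡⟨ regroup a b (M (r + s)) ⟩
  ((a + b) + M (r + s)) + a + b           ≡⟨ cong₂ _+_ (cong₂ _+_ Mm+n Mm) Mn ⟨
  M (m + n) + M m + M n                   ∎
  where
  open ≡-Reasoning
  open NatSolver using (solve; _:+_; _:*_; _:=_; con)
  M : ℕ → ℕ
  M = multiples e
  a r b s : ℕ
  a = m / e
  r = m % e
  b = n / e
  s = n % e
  r<e : r < e
  r<e = m%n<n m e
  s<e : s < e
  s<e = m%n<n n e
  2r+1≡e : suc (r + r) ≡ e
  2r+1≡e = odd-residue e a r r<e (subst (λ x → e ∣ℕ 2 * x + 1) (euclidean-division m e) e∣2m+1)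
  M-combination : ∀ x t u → x ≡ t * e + u → M x ≡ t + M u
  M-combination x t u refl = multiples-linear e t u 1≤e
  double : ∀ t u e → 2 * (t * e + u) ≡ (2 * t) * e + (u + u)
  double = solve 3 (λ t u e → con 2 :* (t :* e :+ u) := (con 2 :* t) :* e :+ (u :+ u)) refl
  M2m : M (2 * m) ≡ 2 * a
  M2m = trans (M-combination (2 * m) (2 * a) (r + r) (trans (cong (2 *_) (euclidean-division m e)) (double a r e)))
              (trans (cong (2 * a +_) (multiples-small e (r + r) (subst (r + r <_) 2r+1≡e ≤-refl))) (+-identityʳ (2 * a)))
  M2n : M (2 * n) ≡ 2 * b + M (s + s)
  M2n = M-combination (2 * n) (2 * b) (s + s) (trans (cong (2 *_) (euclidean-division n e)) (double b s e))
  Mm : M m ≡ a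
  Mm = trans (M-combination m a r (euclidean-division m e)) (trans (cong (a +_) (multiples-small e r r<e)) (+-identityʳ a))
  Mn : M n ≡ b
  Mn = trans (M-combination n b s (euclidean-division n e)) (trans (cong (b +_) (multiples-small e s s<e)) (+-identityʳ b))
  Mm+n : M (m + n) ≡ (a + b) + M (r + s)
  Mm+n = M-combination (m + n) (a + b) (r + s)
    (trans (cong₂ _+_ (euclidean-division m e) (euclidean-division n e)) (sum a r b s e))
    where
    sum : ∀ a r b s e → (a * e + r) + (b * e + s) ≡ (a + b) * e + (r + s)
    sum = solve 5 (λ a r b s e → (a :* e :+ r) :+ (b :* e :+ s) := (a :+ b) :* e :+ (r :+ s)) refl
  regroup : ∀ a b z → 2 * a + (2 * b + z) ≡ ((a + b) + z) + a + b
  regroup = solve 3 (λ a b z → con 2 :* a :+ (con 2 :* b :+ z) := ((a :+ b) :+ z) :+ a :+ b) refl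

infixr 8 _^ₚ_
_^ₚ_ : Poly → ℕ → Poly
f ^ₚ zero  = oneₚ
f ^ₚ suc t = f *ₚ f ^ₚ t

^ₚ-+ : ∀ f a b → f ^ₚ (a + b) ≋ f ^ₚ a *ₚ f ^ₚ b
^ₚ-+ f zero    b = ≋-sym (*ₚ-identityˡ (f ^ₚ b))
^ₚ-+ f (suc a) b = ≋-trans (*ₚ-congʳ f (^ₚ-+ f a b)) (≋-sym (*ₚ-assoc f (f ^ₚ a) (f ^ₚ b)))

^ₚ-nonzero : ∀ f t → size f ≢ 0 → size (f ^ₚ t) ≢ 0
^ₚ-nonzero f zero    f≢0 ()
^ₚ-nonzero f (suc t) f≢0 = nonzero-*ₚ f (f ^ₚ t) f≢0 (^ₚ-nonzero f t f≢0)

^ₚ-factors : ∀ f k l U V {x y} → x ≋ f ^ₚ k *ₚ U → y ≋ f ^ₚ l *ₚ V → x *ₚ y ≋ f ^ₚ (k + l) *ₚ (U *ₚ V)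
^ₚ-factors f k l U V {x} {y} x≋ y≋ = begin
  x *ₚ y                          ≈⟨ *ₚ-cong x≋ y≋ ⟩
  f ^ₚ k *ₚ U *ₚ (f ^ₚ l *ₚ V)     ≈⟨ regroup (f ^ₚ k) U (f ^ₚ l) V ⟩
  f ^ₚ k *ₚ f ^ₚ l *ₚ (U *ₚ V)     ≈⟨ *ₚ-congˡ (U *ₚ V) (≋-sym (^ₚ-+ f k l)) ⟩
  f ^ₚ (k + l) *ₚ (U *ₚ V)         ∎
  where
  open ≋-Reasoning
  open PolySolver using (solve; _:*_; _:=_)
  regroup : ∀ P U Q V → P *ₚ U *ₚ (Q *ₚ V) ≋ P *ₚ Q *ₚ (U *ₚ V)
  regroup = solve 4 (λ P U Q V → P :* U :* (Q :* V) := P :* Q :* (U :* V)) ≋-refl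

-- [e] ≠ 0 for e ≥ 1, as its constant term is 1.
qint-nonzero : ∀ e → 1 ≤ e → size (qint e) ≢ 0
qint-nonzero (suc e) _ s≡0 = <⇒≱ (nonzero⇒<size (qint (suc e)) 0 λ ()) (subst (_≤ 0) (sym s≡0) z≤n)

module DecisiveFactorOfQint
  (N K : ℕ) (p : Poly) (p∣[N+1] : p ∣ qint (suc N)) (p-decisive : Decisive qint K p)
  (e : ℕ) (1≤e : 1 ≤ e) (p∣[e] : p ∣ qint e) (p⊥[k] : ∀ k → 1 ≤ k → k < e → Coprime p (qint k)) where

  open Decisive p-decisive

  instance
    e-nonzero : NonZero e
    e-nonzero = >-nonZero 1≤e

  not-both : ∀ {f} → p ∣ f → Coprime p f → ⊥
  not-both p∣f p⊥f = <⇒≱ nonunit (≤-reflexive (unit⇒size≡1 p (coprime-divisor⇒unit p∣f p⊥f)))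

  residue-zero : ∀ r → r < e → p ∣ qint r → r ≡ 0
  residue-zero zero    _   _     = refl
  residue-zero (suc r) r<e p∣[r] = ⊥-elim (not-both p∣[r] (p⊥[k] (suc r) (s≤s z≤n) r<e))

  -- Write k = t·e + r; p | [t·e] and p | [k] give p | [r], so r = 0.
  p∣[k]⇒e∣k : ∀ k → p ∣ qint k → e ∣ℕ k
  p∣[k]⇒e∣k k p∣[k] = m%n≡0⇒n∣m k e (residue-zero (k % e) (m%n<n k e) p∣[r])
    where
    p∣[te] : p ∣ qint (k / e * e)
    p∣[te] = ∣-resp (≋-sym (qint-multiple e (k / e))) (∣-*ₚʳ (geom e (k / e)) p∣[e])
    p∣[r] : p ∣ qint (k % e)
    p∣[r] = qint-difference N (k / e * e) (k % e) p∣[N+1] p∣[te]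
              (subst (λ x → p ∣ qint x) (euclidean-division k e) p∣[k])

  E : Poly
  E = qint e

  record Split (k : ℕ) : Set where
    constructor split
    field
      cofactor         : Poly
      equation         : qfact k ≋ E ^ₚ multiples e k *ₚ cofactor
      coprime-cofactor : Coprime p cofactor

  -- geom e (j + 1) ≡ j + 1 modulo [e], a nonzero constant
  coprime-geom : ∀ j → Coprime p (geom e (suc j))
  coprime-geom j = coprime-to-nonzero-constant {H = proj₁ g} (ℕ→ℚ (suc j)) (ℕ→ℚ-suc≢0 j) p∣[e] (proj₂ g)
    where
    g : Σ Poly λ H → geom e (suc j) ≋ constₚ (ℕ→ℚ (suc j)) +ₚ qint e *ₚ H
    g = geom-mod-qint e (suc j)

  -- Passing from [k]! to [k + 1]! when k + 1 = j·e: the new factor is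
  -- [e]·geom e j, and geom e j is coprime to p.
  split-multiple : ∀ k j → suc k ≡ suc j * e → Split k → Split (suc k)
  split-multiple k j k+1≡je (split U qfact≋ p⊥U) = split (G *ₚ U) (begin
    qint (suc k) *ₚ qfact k                ≈⟨ *ₚ-cong [k+1]≋ qfact≋ ⟩
    E *ₚ G *ₚ (E ^ₚ c *ₚ U)                ≈⟨ regroup E G (E ^ₚ c) U ⟩
    E ^ₚ suc c *ₚ (G *ₚ U)                 ≡⟨ cong (λ x → E ^ₚ x *ₚ (G *ₚ U)) (multiples-step-∣ e k (divides (suc j) k+1≡je)) ⟨
    E ^ₚ multiples e (suc k) *ₚ (G *ₚ U)   ∎)
    (coprime-*ₚ (coprime-geom j) p⊥U)
    where
    open ≋-Reasoning
    open PolySolver using (solve; _:*_; _:=_)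
    G : Poly
    G = geom e (suc j)
    c : ℕ
    c = multiples e k
    [k+1]≋ : qint (suc k) ≋ E *ₚ G
    [k+1]≋ = ≋-trans (coeffwise λ i → cong (λ x → coeff (qint x) i) k+1≡je) (qint-multiple e (suc j))
    regroup : ∀ E G P U → E *ₚ G *ₚ (P *ₚ U) ≋ E *ₚ P *ₚ (G *ₚ U)
    regroup = solve 4 (λ E G P U → E :* G :* (P :* U) := E :* P :* (G :* U)) ≋-refl

  split-coprime : ∀ k → ¬ e ∣ℕ suc k → Coprime p (qint (suc k)) → Split k → Split (suc k)
  split-coprime k e∤k+1 p⊥[k+1] (split U qfact≋ p⊥U) = split (qint (suc k) *ₚ U) (begin
    qint (suc k) *ₚ qfact k                          ≈⟨ *ₚ-congʳ (qint (suc k)) qfact≋ ⟩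
    qint (suc k) *ₚ (E ^ₚ multiples e k *ₚ U)        ≈⟨ swap (qint (suc k)) (E ^ₚ multiples e k) U ⟩
    E ^ₚ multiples e k *ₚ (qint (suc k) *ₚ U)        ≡⟨ cong (λ x → E ^ₚ x *ₚ (qint (suc k) *ₚ U)) (multiples-step-∤ e k e∤k+1) ⟨
    E ^ₚ multiples e (suc k) *ₚ (qint (suc k) *ₚ U)  ∎)
    (coprime-*ₚ p⊥[k+1] p⊥U)
    where
    open ≋-Reasoning
    open PolySolver using (solve; _:*_; _:=_)
    swap : ∀ Q P U → Q *ₚ (P *ₚ U) ≋ P *ₚ (Q *ₚ U)
    swap = solve 3 (λ Q P U → Q :* (P :* U) := P :* (Q :* U)) ≋-refl

  split-qfact : ∀ k → k < K → Split k
  split-qfact zero    _     = split oneₚ (≋-sym (*ₚ-identityˡ oneₚ)) (coprime-oneₚ p)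
  split-qfact (suc k) k+1<K = step (split-qfact k (<-trans (n<1+n k) k+1<K))
    where
    step : Split k → Split (suc k)
    step split-k with e ∣? suc k | decides (suc k) k+1<K
    ... | yes (divides (suc j) k+1≡je) | _            = split-multiple k j k+1≡je split-k
    ... | no e∤k+1                     | inj₁ p∣[k+1] = ⊥-elim (e∤k+1 (p∣[k]⇒e∣k (suc k) p∣[k+1]))
    ... | no e∤k+1                     | inj₂ p⊥[k+1] = split-coprime k e∤k+1 p⊥[k+1] split-k

  -- If S·[m+n]![m]![n]! = [2m]![2n]! with N = 2m, then p does not divide S:
  -- the powers of [e] on both sides agree (multiples-balance), and after
  -- cancelling them p would divide a product of polynomials coprime to p.
  not-divides-quotient : ∀ m n S → N ≡ 2 * m → 2 * m + 2 * n < K →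
    S *ₚ (qfact (m + n) *ₚ qfact m *ₚ qfact n) ≋ qfact (2 * m) *ₚ qfact (2 * n) → p ∣ S → ⊥
  not-divides-quotient m n S refl bound S-eq p∣S =
    not-both (∣-resp cancelled (∣-*ₚˡ W p∣S)) (coprime-*ₚ (coprime-cofactor s₄) (coprime-cofactor s₅))
    where
    open Split
    split-below : ∀ k → k ≤ 2 * m + 2 * n → Split k
    split-below k k≤ = split-qfact k (≤-<-trans k≤ bound)
    m≤2m : ∀ m → m ≤ 2 * m
    m≤2m m = m≤m+n m (m + 0)
    s₁ : Split (m + n)
    s₁ = split-below (m + n) (+-mono-≤ (m≤2m m) (m≤2m n))
    s₂ : Split m
    s₂ = split-below m (≤-trans (m≤2m m) (m≤m+n (2 * m) (2 * n)))
    s₃ : Split n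
    s₃ = split-below n (≤-trans (m≤2m n) (m≤n+m (2 * n) (2 * m)))
    s₄ : Split (2 * m)
    s₄ = split-below (2 * m) (m≤m+n (2 * m) (2 * n))
    s₅ : Split (2 * n)
    s₅ = split-below (2 * n) (m≤n+m (2 * n) (2 * m))
    U₁ U₂ U₃ : Poly
    U₁ = cofactor s₁
    U₂ = cofactor s₂
    U₃ = cofactor s₃
    W : Poly
    W = U₁ *ₚ U₂ *ₚ U₃
    k₁ k₂ k₃ k₄ k₅ a b : ℕ
    k₁ = multiples e (m + n)
    k₂ = multiples e m
    k₃ = multiples e n
    k₄ = multiples e (2 * m)
    k₅ = multiples e (2 * n)
    a = k₁ + k₂ + k₃
    b = k₄ + k₅
    e∣2m+1 : e ∣ℕ 2 * m + 1
    e∣2m+1 = p∣[k]⇒e∣k (2 * m + 1) (subst (λ x → p ∣ qint x) (+-comm 1 (2 * m)) p∣[N+1])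
    denominator : qfact (m + n) *ₚ qfact m *ₚ qfact n ≋ E ^ₚ a *ₚ W
    denominator = ^ₚ-factors E (k₁ + k₂) k₃ (U₁ *ₚ U₂) U₃ (^ₚ-factors E k₁ k₂ U₁ U₂ (equation s₁) (equation s₂)) (equation s₃)
    numerator : qfact (2 * m) *ₚ qfact (2 * n) ≋ E ^ₚ b *ₚ (cofactor s₄ *ₚ cofactor s₅)
    numerator = ^ₚ-factors E k₄ k₅ (cofactor s₄) (cofactor s₅) (equation s₄) (equation s₅)
    cancelled : W *ₚ S ≋ cofactor s₄ *ₚ cofactor s₅
    cancelled = *ₚ-cancelˡ (E ^ₚ b) (W *ₚ S) (cofactor s₄ *ₚ cofactor s₅) (^ₚ-nonzero E b (qint-nonzero e 1≤e)) (begin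
      E ^ₚ b *ₚ (W *ₚ S)                          ≈⟨ ≋-sym (*ₚ-assoc (E ^ₚ b) W S) ⟩
      E ^ₚ b *ₚ W *ₚ S                            ≡⟨ cong (λ x → E ^ₚ x *ₚ W *ₚ S) (multiples-balance e m n 1≤e e∣2m+1) ⟩
      E ^ₚ a *ₚ W *ₚ S                            ≈⟨ *ₚ-congˡ S (≋-sym denominator) ⟩
      qfact (m + n) *ₚ qfact m *ₚ qfact n *ₚ S    ≈⟨ *ₚ-comm (qfact (m + n) *ₚ qfact m *ₚ qfact n) S ⟩
      S *ₚ (qfact (m + n) *ₚ qfact m *ₚ qfact n)  ≈⟨ S-eq ⟩
      qfact (2 * m) *ₚ qfact (2 * n)              ≈⟨ numerator ⟩
      E ^ₚ b *ₚ (cofactor s₄ *ₚ cofactor s₅)      ∎)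
      where open ≋-Reasoning

least-qint-divisor : ∀ N K p → p ∣ qint (suc N) → suc N < K → Decisive qint K p →
  Σ ℕ λ e → 1 ≤ e × p ∣ qint e × (∀ k → 1 ≤ k → k < e → Coprime p (qint k))
least-qint-divisor N K p p∣[N+1] N+1<K (decisive _ decides)
  with least-witness N (λ k k<N → decides (suc k) (<-trans (s≤s k<N) N+1<K)) p∣[N+1]
... | e₀ , p∣[e] , p⊥below = suc e₀ , s≤s z≤n , p∣[e] , λ { (suc k) _ (s≤s k<e₀) → p⊥below k k<e₀ }

zero∤qint : ∀ d N → size d ≡ 0 → ¬ d ∣ qint (suc N)
zero∤qint d N sd (divides g dg≋[N+1]) =
  ℚₚ.1≢0 (at (≋-trans (≋-sym dg≋[N+1]) (*ₚ-zeroˡ d g (size≡0⇒≋[] d sd))) 0)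

-- A common divisor d of S and [2m + 1] is a unit: otherwise d has a
-- decisive factor p (for [0], ..., [2m + 2n + 1]), which divides [2m + 1]
-- and S; this contradicts not-divides-quotient.
lemma6p1 : (m n : ℕ) → 1 ≤ m → 1 ≤ n →
    (S : Poly) →
    S *ₚ (qfact (m + n) *ₚ qfact m *ₚ qfact n) ≈ₚ qfact (2 * m) *ₚ qfact (2 * n) →
    GcdOne S (qint (2 * m + 1))
lemma6p1 m n _ _ S S-eq d (g , dg≈S) (h , dh≈[2m+1]) = unit (size d) refl
  where
  d∣S : d ∣ S
  d∣S = divides g (coeffwise dg≈S)
  d∣[2m+1] : d ∣ qint (suc (2 * m))
  d∣[2m+1] = subst (λ x → d ∣ qint x) (+-comm (2 * m) 1) (divides h (coeffwise dh≈[2m+1]))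
  K : ℕ
  K = suc (suc (2 * m + 2 * n))
  unit : ∀ s → size d ≡ s → d ∣ₚ oneₚ
  unit zero          sd = ⊥-elim (zero∤qint d (2 * m) sd d∣[2m+1])
  unit (suc zero)    sd = let divides w dw≋1 = size≡1⇒unit d sd in w , at dw≋1
  unit (suc (suc _)) sd with decisive-factor qint K d (subst (2 ≤_) (sym sd) (s≤s (s≤s z≤n)))
  ... | p , p∣d , p-decisive
    with least-qint-divisor (2 * m) K p (∣-trans p∣d d∣[2m+1]) (s≤s (s≤s (m≤m+n (2 * m) (2 * n)))) p-decisive
  ...   | e , 1≤e , p∣[e] , p⊥below =
    ⊥-elim (not-divides-quotient m n S refl (n≤1+n _) (coeffwise S-eq) (∣-trans p∣d d∣S))
    where open DecisiveFactorOfQint (2 * m) K p (∣-trans p∣d d∣[2m+1]) p-decisive e 1≤e p∣[e] p⊥below
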